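{- Let $n\ge 1$, let $k\ge 1$ be an integer and let $\lambda\in\mathcal{P}[n]$. Then $$p^{\alpha}_k(X^n)\,G_{\lambda}^{(\alpha,\beta)}(X^n)=\sum_{\nu}(-\alpha-\beta)^{|\nu/\lambda|-k}\,(-1)^{k-c(\nu/\lambda)}\binom{r(\nu/\lambda)-1}{k-c(\nu/\lambda)}\,G_{\nu}^{(\alpha,\beta)}(X^n),$$ where the sum runs over all partitions $\nu\in\mathcal{P}[n]$ such that $\lambda\subseteq\nu$, $c(\nu/\lambda)\le k$, $\nu/\lambda$ is connected, and the maximal ribbon along the northwest border of $\nu/\lambda$ has size (number of boxes) at least $k$.
   Context: Let $n$ be a positive integer, $X^n=(x_1,\dots,x_n)$ commuting indeterminates, and $\alpha,\beta$ further commuting indeterminates (parameters); expressions $\frac{1}{1-\alpha x_i}$ are read as rational functions (or as power series in $x_i$). $\mathcal{P}[n]$ is the set of partitions with at most $n$ nonzero parts, i.e. integer sequences $\lambda=(\lambda_1\ge\cdots\ge\lambda_n\ge 0)$. The Young diagram $Y(\lambda)$ is the top- and left-justified array of boxes with $\lambda_i$ boxes in row $i$ (rows numbered from top to bottom). Write $\lambda\subseteq\nu$ if $\lambda_i\le\nu_i$ for all $i$; then the skew shape $\nu/\lambda$ is the set difference $Y(\nu)-Y(\lambda)$, $|\nu/\lambda|$ is its number of boxes, and $r(\nu/\lambda)$, $c(\nu/\lambda)$ are its numbers of (non-empty) rows and (non-empty) columns. Two boxes are adjacent if they share an edge. A skew shape is connected if every pair of its boxes is joined by a sequence of successively adjacent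 boxes contained in the shape. A ribbon is a connected skew shape containing no $2\times 2$ square of boxes. The maximal ribbon along the northwest border of a connected skew shape $\nu/\lambda$ is the largest possible ribbon of the form $\mu/\lambda$ (with $\mu$ a partition, $\lambda\subseteq\mu\subseteq\nu$) lying within $\nu/\lambda$. The canonical stable Grothendieck function is $$G_{\lambda}^{(\alpha,\beta)}(X^n):=\frac{\det\left[\dfrac{x_i^{\lambda_j+n-j}(1+\beta x_i)^{j-1}}{(1-\alpha x_i)^{\lambda_j}}\right]_{1\le i,j\le n}}{\prod_{1\le i<j\le n}(x_i-x_j)}.$$ For $k\ge 1$, $$p^{\alpha}_k(X^n):=p_k\left(\frac{x_1}{1-\alpha x_1},\dots,\frac{x_n}{1-\alpha x_n}\right)=\sum_{j=1}^n\left(\frac{x_j}{1-\alpha x_j}\right)^k,$$ where $p_k(X^n)=\sum_{j=1}^n x_j^k$ is the power sum. -}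

module Defs where

open import Level using (Level; 0ℓ; _⊔_)
open import Algebra.Bundles using (CommutativeRing)
import Algebra.Definitions
import Algebra.Definitions.RawMonoid
import Algebra.Properties.Semiring.Exp
open import Data.Bool.Base using (if_then_else_)
open import Data.Fin.Base as Fin using (Fin; zero; suc; toℕ)
import Data.Fin.Properties as Fin
open import Data.List.Base using (List; allFin; concatMap; deduplicate; filter; foldr; length; map; upTo)
open import Data.List.Membership.Propositional using (_∈_)
open import Data.List.Relation.Unary.Unique.Propositional using (Unique)
open import Data.Nat.Base using (ℕ; zero; suc; _+_; _∸_; _≤_; _<_; _≥_; ∣_-_∣)
import Data.Nat.Properties as ℕ
open import Data.Product.Base using (Σ-syntax; ∃-syntax; _×_; _,_; proj₁; proj₂)
open import Data.Sum.Base using (_⊎_)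
open import Data.Vec.Base using (Vec; lookup)
open import Data.Vec.Functional using (Vector; removeAt)
open import Data.Vec.Relation.Unary.Linked using (Linked)
open import Function.Base using (_∘_)
open import Function.Bundles using (_⇔_)
open import Relation.Binary.Construct.Closure.ReflexiveTransitive using (Star)
open import Relation.Binary.PropositionalEquality.Core using (_≡_)
open import Relation.Nullary using (Dec; ¬_; yes; no; does; ¬?; _×-dec_)
open import Relation.Unary using (Pred; Decidable; _∖_)

------------------------------------------------------------------------
-- Partitions and skew shapes

-- Partitions with at most n nonzero parts, padded with zeros to length n.
IsPartition : ∀ {n} → Vec ℕ n → Set
IsPartition = Linked _≥_

infix 4 _⊆_
_⊆_ : ∀ {n} → Vec ℕ n → Vec ℕ n → Set
ƛ ⊆ ν = ∀ i → lookup ƛ i ≤ lookup ν i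

-- (row , column), both numbered from 0.
Box : ℕ → Set
Box n = Fin n × ℕ

Shape : ℕ → Set₁
Shape n = Pred (Box n) 0ℓ

Y : ∀ {n} → Vec ℕ n → Shape n
Y ν (i , j) = j < lookup ν i

infix 8 _/_
_/_ : ∀ {n} → Vec ℕ n → Vec ℕ n → Shape n
ν / ƛ = Y ν ∖ Y ƛ

_/?_ : ∀ {n} (ν ƛ : Vec ℕ n) → Decidable (ν / ƛ)
(ν /? ƛ) (i , j) = (j ℕ.<? lookup ν i) ×-dec ¬? (j ℕ.<? lookup ƛ i)

boxes : ∀ {n} → Vec ℕ n → Vec ℕ n → List (Box n)
boxes {n} ν ƛ =
  filter (ν /? ƛ) (concatMap (λ i → map (i ,_) (upTo (lookup ν i))) (allFin n))

∣_/_∣ : ∀ {n} → Vec ℕ n → Vec ℕ n → ℕ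
∣ ν / ƛ ∣ = length (boxes ν ƛ)

r[_/_] : ∀ {n} → Vec ℕ n → Vec ℕ n → ℕ
r[ ν / ƛ ] = length (deduplicate Fin._≟_ (map proj₁ (boxes ν ƛ)))

c[_/_] : ∀ {n} → Vec ℕ n → Vec ℕ n → ℕ
c[ ν / ƛ ] = length (deduplicate ℕ._≟_ (map proj₂ (boxes ν ƛ)))

Adjacent : ∀ {n} → Box n → Box n → Set
Adjacent (i , j) (i′ , j′) =
  (i ≡ i′ × ∣ j - j′ ∣ ≡ 1) ⊎ (∣ toℕ i - toℕ i′ ∣ ≡ 1 × j ≡ j′)

Connected : ∀ {n} → Shape n → Set
Connected S = ∀ a b → S a → S b → Star (λ u v → S u × S v × Adjacent u v) a b

Contains2×2 : ∀ {n} → Shape n → Set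
Contains2×2 S = ∃[ i ] ∃[ i′ ] ∃[ j ] toℕ i′ ≡ suc (toℕ i) ×
  S (i , j) × S (i , suc j) × S (i′ , j) × S (i′ , suc j)

IsRibbon : ∀ {n} → Shape n → Set
IsRibbon S = Connected S × ¬ Contains2×2 S

-- μ / ƛ is a ribbon lying within ν / ƛ.
record NWRibbon {n : ℕ} (ν ƛ μ : Vec ℕ n) : Set where
  field
    isPartition : IsPartition μ
    lower       : ƛ ⊆ μ
    upper       : μ ⊆ ν
    isRibbon    : IsRibbon (μ / ƛ)

record MaximalNWRibbon {n : ℕ} (ν ƛ μ : Vec ℕ n) : Set where
  field
    nwRibbon : NWRibbon ν ƛ μ
    largest  : ∀ μ′ → NWRibbon ν ƛ μ′ → ∣ μ′ / ƛ ∣ ≤ ∣ μ / ƛ ∣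

-- The range of summation for ν.
record Admissible {n : ℕ} (k : ℕ) (ƛ ν : Vec ℕ n) : Set where
  field
    isPartition : IsPartition ν
    ƛ⊆ν         : ƛ ⊆ ν
    columns     : c[ ν / ƛ ] ≤ k
    connected   : Connected (ν / ƛ)
    ribbon      : ∃[ μ ] MaximalNWRibbon ν ƛ μ × k ≤ ∣ μ / ƛ ∣

------------------------------------------------------------------------
-- Algebra over a commutative ring

module RingDefs {c ℓ : Level} (R : CommutativeRing c ℓ) where

  open CommutativeRing R hiding (zero) renaming (_+_ to _+ᴿ_)
  open Algebra.Definitions.RawMonoid +-rawMonoid public
    using (sum) renaming (_×_ to _·_)
  open Algebra.Definitions.RawMonoid *-rawMonoid public
    using () renaming (sum to product)
  open Algebra.Properties.Semiring.Exp semiring public using (_^_)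
  open import Relation.Binary.Reasoning.Setoid setoid

  Unit : Pred Carrier (c ⊔ ℓ)
  Unit = Algebra.Definitions.Invertible _≈_ 1# _*_

  infixl 7 _÷_[_]
  _÷_[_] : Carrier → (b : Carrier) → Unit b → Carrier
  a ÷ b [ b⁻¹ , _ ] = a * b⁻¹

  1-unit : Unit 1#
  1-unit = 1# , *-identityˡ 1# , *-identityˡ 1#

  *-unit : ∀ {a b} → Unit a → Unit b → Unit (a * b)
  *-unit {a} {b} (a⁻¹ , a⁻¹a≈1 , _) (b⁻¹ , b⁻¹b≈1 , _) =
    b⁻¹ * a⁻¹ , inverseˡ , trans (*-comm _ _) inverseˡ
    where
    inverseˡ : (b⁻¹ * a⁻¹) * (a * b) ≈ 1#
    inverseˡ = begin
      (b⁻¹ * a⁻¹) * (a * b)  ≈⟨ *-assoc _ _ _ ⟩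
      b⁻¹ * (a⁻¹ * (a * b))  ≈⟨ *-congˡ (*-assoc _ _ _) ⟨
      b⁻¹ * ((a⁻¹ * a) * b)  ≈⟨ *-congˡ (*-congʳ a⁻¹a≈1) ⟩
      b⁻¹ * (1# * b)         ≈⟨ *-congˡ (*-identityˡ b) ⟩
      b⁻¹ * b                ≈⟨ b⁻¹b≈1 ⟩
      1#                     ∎

  ^-unit : ∀ {a} → Unit a → ∀ m → Unit (a ^ m)
  ^-unit u zero    = 1-unit
  ^-unit u (suc m) = *-unit u (^-unit u m)

  product-unit : ∀ {m} {f : Vector Carrier m} → (∀ i → Unit (f i)) → Unit (product f)
  product-unit {zero}  u = 1-unit
  product-unit {suc m} u = *-unit (u zero) (product-unit (u ∘ suc))

  -- Laplace expansion along the first row.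
  det : ∀ {m} → Vector (Vector Carrier m) m → Carrier
  det {zero}  M = 1#
  det {suc m} M =
    sum λ j → (- 1#) ^ toℕ j * M zero j * det (λ i → removeAt (M (suc i)) j)

  -- The product of f i j over all pairs i < j.
  ∏< : ∀ {m} → (Fin m → Fin m → Carrier) → Carrier
  ∏< f = product λ i → product λ j → if does (i Fin.<? j) then f i j else 1#

  if-unit : ∀ {p} {P : Set p} {a} (P? : Dec P) → (P → Unit a) →
            Unit (if does P? then a else 1#)
  if-unit (yes p) u = u p
  if-unit (no _)  u = 1-unit

  ∏<-unit : ∀ {m} {f : Fin m → Fin m → Carrier} →
            (∀ i j → i Fin.< j → Unit (f i j)) → Unit (∏< f)
  ∏<-unit u = product-unit λ i → product-unit λ j → if-unit (i Fin.<? j) (u i j)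

  powerSum : ∀ {m} → ℕ → Vector Carrier m → Carrier
  powerSum k y = sum λ j → y j ^ k

  -- s is the sum of f over the subset P of A: P is finite, enumerated
  -- without repetition by some list, and s is the sum along that list.
  infix 4 _≈∑⟨_⟩_
  _≈∑⟨_⟩_ : ∀ {a p} {A : Set a} → Carrier → Pred A p → (A → Carrier) → Set (a ⊔ p ⊔ ℓ)
  _≈∑⟨_⟩_ {A = A} s P f = Σ[ as ∈ List A ]
    Unique as × (∀ a → (a ∈ as) ⇔ P a) × s ≈ foldr (λ a t → f a +ᴿ t) 0# as

  -- The x i, α and β may be any ring elements for which the denominators are
  -- units.  Indeterminates are the generic instance: R is then the field of
  -- rational functions, or ℤ[x, α, β] with these denominators inverted.
  module Grothendieck
    {n : ℕ} (α β : Carrier) (x : Vector Carrier n)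
    (1-αx-unit : ∀ i → Unit (1# - α * x i))
    (x-x-unit : ∀ i j → i Fin.< j → Unit (x i - x j))
    where

    -- With columns numbered from 0, the exponents n - j and j - 1 become
    -- n ∸ suc (toℕ j) and toℕ j.
    G : Vec ℕ n → Carrier
    G ƛ =
      det (λ i j →
        (x i ^ (lookup ƛ j + (n ∸ suc (toℕ j))) * (1# +ᴿ β * x i) ^ toℕ j)
          ÷ (1# - α * x i) ^ lookup ƛ j [ ^-unit (1-αx-unit i) (lookup ƛ j) ])
      ÷ ∏< (λ i j → x i - x j) [ ∏<-unit x-x-unit ]

    pᵅ : ℕ → Carrier
    pᵅ k = powerSum k λ j → x j ÷ (1# - α * x j) [ 1-αx-unit j ]

-- Put y = x / (1 - αx), δ = - α - β and let col be the column y ^ λⱼ x ^ (n - j) (1 + βx) ^ (j - 1)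
-- of the determinant.  Multiplying by pᵅ k adds k to one entry λ_b at a time, summed over b.  The
-- columns of successive rows are related by
--   col (j) (e) = col (j + 1) (e + 1) + δ col (j) (e + 1),
-- where e is the entry.  Read from right to left, it moves the enlarged column up past the columns
-- with smaller entries; d moves produce (- 1) ^ d and a binomial coefficient, and the expansion is
-- cut off correctly because equal columns cancel.  Once the column has found its row a, the columns
-- of rows a, …, b - 1 stand one row too low; read from left to right and from the top down, the
-- relation adapts them, and since again equal columns cancel it yields exactly the chains
-- λ_{i-1} < ν_i ≤ ν_{i-1}, that is, the partitions ν with ν / λ connected with rows a, …, b.  Its
-- maximal ribbon meets all r rows and all c columns, so it has r + c - 1 boxes, and the bound
-- k ≤ r + c - 1 says that the binomial coefficient does not vanish.

module Submission where

open import Defs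
open import Level using (_⊔_)
open import Algebra.Bundles using (CommutativeRing)
import Algebra.Properties.CommutativeSemiring.Exp as CommutativeExp
import Algebra.Properties.Ring as RingProperties
import Algebra.Properties.Semiring.Exp as Exp
import Algebra.Properties.Semiring.Mult as Mult
import Algebra.Properties.Semiring.Sum as Sum
import Algebra.Solver.Ring.NaturalCoefficients.Default as Solver
open import Data.Bool.Base using (if_then_else_)
open import Data.Empty using (⊥)
open import Data.Fin.Base as Fin using (Fin; zero; suc; toℕ; punchIn; punchOut)
import Data.Fin.Properties as Fin
open import Data.List.Base using (List; []; _∷_; _++_; allFin; concatMap; deduplicate; filter; foldr; length; map; tabulate; upTo)
open import Data.List.Membership.Propositional using (_∈_; find)
open import Data.List.Membership.Propositional.Properties
open import Data.List.Membership.Propositional.Properties.WithK using (unique∧set⇒bag)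
open import Data.List.Properties using (length-map; length-++; filter-++; length-upTo; map-tabulate; tabulate-cong)
open import Data.List.Relation.Binary.BagAndSetEquality using (∼bag⇒↭)
open import Data.List.Relation.Binary.Permutation.Propositional.Properties using (↭-length)
open import Data.List.Relation.Unary.All as All using ([]; _∷_)
open import Data.List.Relation.Unary.AllPairs using ([]; _∷_)
open import Data.List.Relation.Unary.Any as Any using (here; there)
open import Data.List.Relation.Unary.Unique.Propositional using (Unique)
import Data.List.Relation.Unary.Unique.Propositional.Properties as Unique
import Data.List.Relation.Unary.Unique.DecPropositional.Properties as DecUnique
open import Data.Nat.Base as ℕ using (ℕ; zero; suc; pred; _∸_; _⊓_; _≤_; _<_; ∣_-_∣; z≤n; s≤s)
open import Data.Nat.Combinatorics using (_C_; nCk+nC[k+1]≡[n+1]C[k+1]; k>n⇒nCk≡0)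
import Data.Nat.ListAction as ListAction
import Data.Nat.Properties as ℕ
open import Data.Nat.Solver using (module +-*-Solver)
open import Data.Product.Base using (∃-syntax; _×_; _,_; proj₁; proj₂)
open import Data.Sum.Base using (_⊎_; inj₁; inj₂)
open import Data.Unit.Base using (⊤; tt)
open import Data.Vec.Base using (Vec; []; _∷_; lookup; _[_]%=_)
open import Data.Vec.Functional using (Vector; removeAt)
open import Data.Vec.Properties using (∷-injectiveʳ; lookup∘updateAt; lookup∘updateAt′)
open import Data.Vec.Relation.Unary.Linked as Linked using ([]; [-]; _∷_)
open import Function.Base using (_∘_)
open import Function.Bundles using (_⇔_; mk⇔; Equivalence)
open import Relation.Binary.Construct.Closure.ReflexiveTransitive using (Star; ε; _◅_; _◅◅_; gmap; reverse)
open import Relation.Binary.PropositionalEquality.Core as ≡ using (_≡_; _≢_)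
open import Relation.Nullary using (Dec; ¬_; yes; no; does; contradiction; _×-dec_)
open import Relation.Nullary.Decidable using (dec-true; dec-false)

-- The columns of different rows belong to different families, so an enlarged column cannot be
-- sorted into place as for Schur functions: a transposition leaves both columns in a foreign row.
-- The relation between successive rows repairs this at the cost of a second term with factor δ. For
-- δ = 0 it only shifts the entry, and the result is the classical Murnaghan-Nakayama rule with
-- ribbons of size k. Where an enlarged column stops depends on rows above it, while the induction
-- removes rows from the top. Therefore the determinant is replaced by an arbitrary alternating
-- function of the remaining columns, and the columns that have not found their row yet are carried
-- along in a second sum, `pending`, collected by their current entry. The theorem asks for a list
-- of exactly the admissible ν. So `strips` is built by the same recursion as the expansion, while
-- `Chain` and `Strip` record the few numbers from which both the coefficient of ν and the geometry
-- of ν / λ can be read off.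

module SkewShapes where

  open import Data.Nat.Base using (_+_)
  open import Relation.Binary.PropositionalEquality

  -- Enumeration of the shapes

  interval : ℕ → ℕ → List ℕ
  interval p zero    = []
  interval p (suc d) = suc p ∷ interval (suc p) d

  interval-++ : ∀ p d e → interval p (d + e) ≡ interval p d ++ interval (p + d) e
  interval-++ p zero    e = cong (λ q → interval q e) (sym (ℕ.+-identityʳ p))
  interval-++ p (suc d) e rewrite ℕ.+-suc p d = cong (suc p ∷_) (interval-++ (suc p) d e)

  prepend : ∀ {m} → List ℕ → (ℕ → List (Vec ℕ m)) → List (Vec ℕ (suc m))
  prepend vs f = concatMap (λ v → map (v ∷_) (f v)) vs

  only : ∀ {m} {P : Set} → Dec P → Vec ℕ m → List (Vec ℕ m)
  only P? ƛ = if does P? then ƛ ∷ [] else []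

  -- The number d of further rows and the first column b of the lowest row are known only where the
  -- chain stops, so `Q?` is tested there; each further row shifts its first argument by one.
  chains : ∀ {m} {Q : ℕ → ℕ → Set} → (∀ d b → Dec (Q d b)) → ℕ → ℕ → Vec ℕ m → List (Vec ℕ m)
  chains Q? v l []       = only (Q? 0 l) []
  chains Q? v l (l′ ∷ ƛ) = only (Q? 0 l) (l′ ∷ ƛ) ++
    prepend (interval l (v ∸ l)) λ v′ → chains (Q? ∘ suc) v′ l′ ƛ

  -- If `v` is the end of the top row, `v ∸ b` is the number of columns. Outside this range the
  -- lower index of the binomial coefficient would be negative or exceed d.
  Window : ℕ → ℕ → ℕ → ℕ → Set
  Window k v d b = v ∸ b ≤ k × k ≤ (v ∸ b) + d

  window? : ∀ k v d b → Dec (Window k v d b)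
  window? k v d b = (v ∸ b ℕ.≤? k) ×-dec (k ℕ.≤? (v ∸ b) + d)

  -- The bound `U` keeps ν a partition at the top of the shape: a first nonempty row must not exceed
  -- the unchanged row above it, whose entry is passed on as the new bound.
  strips : ∀ {m} → ℕ → ℕ → Vec ℕ m → List (Vec ℕ m)
  strips k U []      = []
  strips k U (l ∷ ƛ) =
    prepend (interval l (U ∸ l)) (λ v → chains (window? k v) v l ƛ) ++ map (l ∷_) (strips k l ƛ)

  -- The rows of ν / ƛ continue a connected shape downwards from a row of boxes in the columns from p
  -- up to q: d further rows are nonempty, the lowest one starts in column b, and the overlaps v ∸ p
  -- of successive rows, each reduced by 1, add up to e.
  data Chain : ∀ {m} → ℕ → ℕ → Vec ℕ m → Vec ℕ m → ℕ → ℕ → ℕ → Set where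
    stop : ∀ {m p q} {ƛ : Vec ℕ m} → Chain p q ƛ ƛ 0 p 0
    step : ∀ {m p q l v d b e} {ƛ ν : Vec ℕ m} → p < v → v ≤ q → Chain l v ƛ ν d b e →
           Chain p q (l ∷ ƛ) (v ∷ ν) (suc d) b (v ∸ suc p + e)

  -- A connected nonempty ν / ƛ occupying d + 1 rows and the columns from b up to t, with t ≤ U if its
  -- top row is the first one.
  data Strip : ∀ {m} → ℕ → Vec ℕ m → Vec ℕ m → ℕ → ℕ → ℕ → ℕ → Set where
    here  : ∀ {m U l v d b e} {ƛ ν : Vec ℕ m} → l < v → v ≤ U → Chain l v ƛ ν d b e →
            Strip U (l ∷ ƛ) (v ∷ ν) v d b e
    there : ∀ {m U l t d b e} {ƛ ν : Vec ℕ m} → Strip l ƛ ν t d b e →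
            Strip U (l ∷ ƛ) (l ∷ ν) t d b e

  ∈-interval⁻ : ∀ {v} p d → v ∈ interval p d → p < v × v ≤ p + d
  ∈-interval⁻ p (suc d) (here refl) = ℕ.≤-refl , ℕ.m<m+n p (s≤s z≤n)
  ∈-interval⁻ p (suc d) (there v∈) with p<v , v≤ ← ∈-interval⁻ (suc p) d v∈ =
    ℕ.<-trans (ℕ.n<1+n p) p<v , ℕ.≤-trans v≤ (ℕ.≤-reflexive (sym (ℕ.+-suc p d)))

  ∈-interval⁺ : ∀ {v} p d → p < v → v ≤ p + d → v ∈ interval p d
  ∈-interval⁺ p zero    p<v v≤ = contradiction (ℕ.≤-trans v≤ (ℕ.≤-reflexive (ℕ.+-identityʳ p))) (ℕ.<⇒≱ p<v)
  ∈-interval⁺ {v} p (suc d) p<v v≤ with v ℕ.≟ suc p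
  ... | yes refl = here refl
  ... | no v≢   = there (∈-interval⁺ (suc p) d (ℕ.≤∧≢⇒< p<v (v≢ ∘ sym))
                    (ℕ.≤-trans v≤ (ℕ.≤-reflexive (ℕ.+-suc p d))))

  ∈-interval-∸⁻ : ∀ {v} p q → v ∈ interval p (q ∸ p) → p < v × v ≤ q
  ∈-interval-∸⁻ {v} p q v∈ with p<v , v≤ ← ∈-interval⁻ p (q ∸ p) v∈ =
    p<v , ℕ.≤-trans v≤ (ℕ.≤-reflexive (ℕ.m+[n∸m]≡n p≤q))
    where
    p≤q : p ≤ q
    p≤q with p ℕ.≤? q
    ... | yes p≤q = p≤q
    ... | no p≰q  = contradiction (ℕ.≤-trans v≤ (ℕ.≤-reflexive
      (trans (cong (p +_) (ℕ.m≤n⇒m∸n≡0 (ℕ.≰⇒≥ p≰q))) (ℕ.+-identityʳ p)))) (ℕ.<⇒≱ p<v)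

  ∈-interval-∸⁺ : ∀ {v p q} → p < v → v ≤ q → v ∈ interval p (q ∸ p)
  ∈-interval-∸⁺ {v} {p} {q} p<v v≤q = ∈-interval⁺ p (q ∸ p) p<v
    (ℕ.≤-trans v≤q (ℕ.≤-reflexive (sym (ℕ.m+[n∸m]≡n (ℕ.<⇒≤ (ℕ.<-≤-trans p<v v≤q))))))

  interval-unique : ∀ p d → Unique (interval p d)
  interval-unique p zero    = []
  interval-unique p (suc d) =
    All.tabulate (λ v∈ → ℕ.<⇒≢ (proj₁ (∈-interval⁻ (suc p) d v∈))) ∷ interval-unique (suc p) d

  ∈-prepend⁻ : ∀ {m} {ν : Vec ℕ (suc m)} vs (f : ℕ → List (Vec ℕ m)) → ν ∈ prepend vs f →
    ∃[ v ] ∃[ ν′ ] ν ≡ v ∷ ν′ × v ∈ vs × ν′ ∈ f v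
  ∈-prepend⁻ vs f ν∈ with v , v∈ , ν∈′ ← find (∈-concatMap⁻ (λ v → map (v ∷_) (f v)) ν∈)
                        with ν′ , ν′∈ , eq ← ∈-map⁻ (v ∷_) ν∈′ =
    v , ν′ , eq , v∈ , ν′∈

  ∈-prepend⁺ : ∀ {m v} {ν : Vec ℕ m} {vs} (f : ℕ → List (Vec ℕ m)) → v ∈ vs → ν ∈ f v → v ∷ ν ∈ prepend vs f
  ∈-prepend⁺ {v = v} f v∈ ν∈ = ∈-concatMap⁺ (λ v → map (v ∷_) (f v)) (Any.map (λ { refl → ∈-map⁺ (v ∷_) ν∈ }) v∈)

  prepend-unique : ∀ {m vs} (f : ℕ → List (Vec ℕ m)) → Unique vs →
    (∀ {v} → v ∈ vs → Unique (f v)) → Unique (prepend vs f)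
  prepend-unique f []        h = []
  prepend-unique {vs = v ∷ vs} f (v∉ ∷ u) h = Unique.++⁺ (Unique.map⁺ ∷-injectiveʳ (h (here refl)))
    (prepend-unique f u (h ∘ there)) λ (ν∈ , ν∈′) → disjoint ν∈ ν∈′
    where
    disjoint : ∀ {ν} → ν ∈ map (v ∷_) (f v) → ν ∈ prepend vs f → ⊥
    disjoint ν∈ ν∈′ with _ , _ , refl ← ∈-map⁻ (v ∷_) ν∈ | _ , _ , refl , v∈ , _ ← ∈-prepend⁻ vs f ν∈′ =
      All.lookup v∉ v∈ refl

  ∈-only⁻ : ∀ {m} {P : Set} {P? : Dec P} {ƛ ν : Vec ℕ m} → ν ∈ only P? ƛ → ν ≡ ƛ × P
  ∈-only⁻ {P? = yes p} (here refl) = refl , p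

  ∈-only⁺ : ∀ {m} {P : Set} (P? : Dec P) {ƛ : Vec ℕ m} → P → ƛ ∈ only P? ƛ
  ∈-only⁺ (yes _) p = here refl
  ∈-only⁺ (no ¬p) p = contradiction p ¬p

  only-unique : ∀ {m} {P : Set} (P? : Dec P) {ƛ : Vec ℕ m} → Unique (only P? ƛ)
  only-unique (yes _) = [] ∷ []
  only-unique (no _)  = []

  ∈-chains⁻ : ∀ {m} {Q : ℕ → ℕ → Set} (Q? : ∀ d b → Dec (Q d b)) {v l} {ƛ ν : Vec ℕ m} → ν ∈ chains Q? v l ƛ →
    ∃[ d ] ∃[ b ] ∃[ e ] Chain l v ƛ ν d b e × Q d b
  ∈-chains⁻ Q? {l = l} {ƛ = []} ν∈ with refl , q ← ∈-only⁻ {P? = Q? 0 l} ν∈ = _ , _ , _ , stop , q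
  ∈-chains⁻ Q? {v} {l} {l′ ∷ ƛ} ν∈ with ∈-++⁻ (only (Q? 0 l) (l′ ∷ ƛ)) ν∈
  ... | inj₁ ν∈′ with refl , q ← ∈-only⁻ {P? = Q? 0 l} ν∈′ = _ , _ , _ , stop , q
  ... | inj₂ ν∈′ with v′ , ν′ , refl , v′∈ , ν′∈ ← ∈-prepend⁻ (interval l (v ∸ l)) (λ v′ → chains (λ d → Q? (suc d)) v′ l′ ƛ) ν∈′
                 with l<v′ , v′≤v ← ∈-interval-∸⁻ l v v′∈ | _ , _ , _ , ch , q ← ∈-chains⁻ (λ d → Q? (suc d)) ν′∈ =
    _ , _ , _ , step l<v′ v′≤v ch , q

  ∈-chains⁺ : ∀ {m} {Q : ℕ → ℕ → Set} (Q? : ∀ d b → Dec (Q d b)) {v l d b e} {ƛ ν : Vec ℕ m} →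
    Chain l v ƛ ν d b e → Q d b → ν ∈ chains Q? v l ƛ
  ∈-chains⁺ Q? {l = l} {ƛ = []}     stop q = ∈-only⁺ (Q? 0 l) q
  ∈-chains⁺ Q? {l = l} {ƛ = l′ ∷ ƛ} stop q = ∈-++⁺ˡ (∈-only⁺ (Q? 0 l) q)
  ∈-chains⁺ Q? {l = l} {ƛ = l′ ∷ ƛ} (step l<v′ v′≤v ch) q = ∈-++⁺ʳ (only (Q? 0 l) (l′ ∷ ƛ))
    (∈-prepend⁺ (λ v′ → chains (λ d → Q? (suc d)) v′ l′ ƛ) (∈-interval-∸⁺ l<v′ v′≤v) (∈-chains⁺ (λ d → Q? (suc d)) ch q))

  chains-unique : ∀ {m} {Q : ℕ → ℕ → Set} (Q? : ∀ d b → Dec (Q d b)) v {l} {ƛ : Vec ℕ m} → IsPartition (l ∷ ƛ) →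
    Unique (chains Q? v l ƛ)
  chains-unique Q? v {l} {[]} p = only-unique (Q? 0 l)
  chains-unique Q? v {l} {l′ ∷ ƛ} (l′≤l ∷ p) = Unique.++⁺ (only-unique (Q? 0 l))
    (prepend-unique tails (interval-unique l (v ∸ l)) λ {v′} _ → chains-unique (λ d → Q? (suc d)) v′ p)
    λ (ν∈ , ν∈′) → disjoint ν∈ ν∈′
    where
    tails : ℕ → List (Vec ℕ _)
    tails v′ = chains (λ d → Q? (suc d)) v′ l′ ƛ
    disjoint : ∀ {ν} → ν ∈ only (Q? 0 l) (l′ ∷ ƛ) → ν ∈ prepend (interval l (v ∸ l)) tails → ⊥
    disjoint ν∈ ν∈′ with refl , _ ← ∈-only⁻ {P? = Q? 0 l} ν∈ | _ , _ , refl , v∈ , _ ← ∈-prepend⁻ (interval l (v ∸ l)) tails ν∈′ =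
      ℕ.<⇒≱ (proj₁ (∈-interval-∸⁻ l v v∈)) l′≤l

  ∈-strips⁻ : ∀ {m} k U {ƛ ν : Vec ℕ m} → ν ∈ strips k U ƛ →
    ∃[ t ] ∃[ d ] ∃[ b ] ∃[ e ] Strip U ƛ ν t d b e × Window k t d b
  ∈-strips⁻ k U {l ∷ ƛ} ν∈
    with ∈-++⁻ (prepend (interval l (U ∸ l)) (λ v → chains (window? k v) v l ƛ)) ν∈
  ... | inj₁ ν∈′ with v , ν′ , refl , v∈ , ν′∈ ← ∈-prepend⁻ (interval l (U ∸ l)) (λ v → chains (window? k v) v l ƛ) ν∈′
                 with l<v , v≤U ← ∈-interval-∸⁻ l U v∈ | _ , _ , _ , ch , w ← ∈-chains⁻ (window? k v) ν′∈ =
    _ , _ , _ , _ , here l<v v≤U ch , w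
  ... | inj₂ ν∈′ with _ , ν′∈ , refl ← ∈-map⁻ (l ∷_) ν∈′
                 with _ , _ , _ , _ , s , w ← ∈-strips⁻ k l ν′∈ = _ , _ , _ , _ , there s , w

  ∈-strips⁺ : ∀ {m k U t d b e} {ƛ ν : Vec ℕ m} → Strip U ƛ ν t d b e → Window k t d b →
    ν ∈ strips k U ƛ
  ∈-strips⁺ {k = k} (here {l = l} {v} {ƛ = ƛ} l<v v≤U ch) w = ∈-++⁺ˡ
    (∈-prepend⁺ (λ v → chains (window? k v) v l ƛ) (∈-interval-∸⁺ l<v v≤U) (∈-chains⁺ (window? k v) ch w))
  ∈-strips⁺ {k = k} {U} (there {l = l} {ƛ = ƛ} s) w =
    ∈-++⁺ʳ (prepend (interval l (U ∸ l)) (λ v → chains (window? k v) v l ƛ))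
      (∈-map⁺ (l ∷_) (∈-strips⁺ s w))

  strips-unique : ∀ {m} k U {ƛ : Vec ℕ m} → IsPartition ƛ → Unique (strips k U ƛ)
  strips-unique k U {[]} p = []
  strips-unique k U {l ∷ ƛ} p = Unique.++⁺
    (prepend-unique heads (interval-unique l (U ∸ l)) λ {v} _ → chains-unique (window? k v) v p)
    (Unique.map⁺ ∷-injectiveʳ (strips-unique k l (Linked.tail p)))
    λ (ν∈ , ν∈′) → disjoint ν∈ ν∈′
    where
    heads : ℕ → List (Vec ℕ _)
    heads v = chains (window? k v) v l ƛ
    disjoint : ∀ {ν} → ν ∈ prepend (interval l (U ∸ l)) heads → ν ∈ map (l ∷_) (strips k l ƛ) → ⊥
    disjoint ν∈ ν∈′ with _ , _ , refl ← ∈-map⁻ (l ∷_) ν∈′ | _ , _ , refl , v∈ , _ ← ∈-prepend⁻ (interval l (U ∸ l)) heads ν∈ =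
      ℕ.<-irrefl refl (proj₁ (∈-interval-∸⁻ l U v∈))

  -- Partition conditions and bounds for strips

  chain-partition : ∀ {m p q d b e} {ƛ ν : Vec ℕ m} → Chain p q ƛ ν d b e → p ≤ q →
    IsPartition (p ∷ ƛ) → IsPartition (q ∷ ν)
  chain-partition stop p≤q [-] = [-]
  chain-partition stop p≤q (l≤p ∷ pƛ) = ℕ.≤-trans l≤p p≤q ∷ pƛ
  chain-partition (step p<v v≤q ch) p≤q (l≤p ∷ pƛ) =
    v≤q ∷ chain-partition ch (ℕ.≤-trans l≤p (ℕ.<⇒≤ p<v)) pƛ

  strip-partition : ∀ {m U t d b e} {ƛ ν : Vec ℕ m} → Strip U ƛ ν t d b e →
    IsPartition (U ∷ ƛ) → IsPartition (U ∷ ν)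
  strip-partition (here l<v v≤U ch) (_ ∷ pƛ)   = v≤U ∷ chain-partition ch (ℕ.<⇒≤ l<v) pƛ
  strip-partition (there s)         (l≤U ∷ pƛ) = l≤U ∷ strip-partition s pƛ

  chain-⊆ : ∀ {m p q d b e} {ƛ ν : Vec ℕ m} → Chain p q ƛ ν d b e → IsPartition (p ∷ ƛ) → ƛ ⊆ ν
  chain-⊆ stop              _          i       = ℕ.≤-refl
  chain-⊆ (step p<v v≤q ch) (l≤p ∷ pƛ) zero    = ℕ.≤-trans l≤p (ℕ.<⇒≤ p<v)
  chain-⊆ (step p<v v≤q ch) (l≤p ∷ pƛ) (suc i) = chain-⊆ ch pƛ i

  strip-⊆ : ∀ {m U t d b e} {ƛ ν : Vec ℕ m} → Strip U ƛ ν t d b e → IsPartition ƛ → ƛ ⊆ ν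
  strip-⊆ (here l<v v≤U ch) pƛ zero    = ℕ.<⇒≤ l<v
  strip-⊆ (here l<v v≤U ch) pƛ (suc i) = chain-⊆ ch pƛ i
  strip-⊆ (there s)         pƛ zero    = ℕ.≤-refl
  strip-⊆ (there s)         pƛ (suc i) = strip-⊆ s (Linked.tail pƛ) i

  chain-bottom : ∀ {m p q d b e} {ƛ ν : Vec ℕ m} → Chain p q ƛ ν d b e → IsPartition (p ∷ ƛ) → b ≤ p
  chain-bottom stop            _          = ℕ.≤-refl
  chain-bottom (step _ _ ch)   (l≤p ∷ pƛ) = ℕ.≤-trans (chain-bottom ch pƛ) l≤p

  strip-<-top : ∀ {m U t d b e} {ƛ ν : Vec ℕ m} → Strip U ƛ ν t d b e → IsPartition ƛ → b < t
  strip-<-top (here l<v _ ch) pƛ = ℕ.≤-<-trans (chain-bottom ch pƛ) l<v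
  strip-<-top (there s)       pƛ = strip-<-top s (Linked.tail pƛ)

  -- `U` constrains only a shape that starts in the first row, and then it bounds `t`. So a strip
  -- found with a bound taken from ν also fits the bound used for the enumeration.
  strip-rebound : ∀ {m U U′ t d b e} {ƛ ν : Vec ℕ m} → Strip U ƛ ν t d b e → t ≤ U′ →
    Strip U′ ƛ ν t d b e
  strip-rebound (here l<v _ ch) t≤U′ = here l<v t≤U′ ch
  strip-rebound (there s)       _    = there s

  -- Counting boxes, rows and columns

  unique-length : ∀ {a} {A : Set a} {xs ys : List A} → Unique xs → Unique ys →
    (∀ {x} → x ∈ xs ⇔ x ∈ ys) → length xs ≡ length ys
  unique-length u u′ h = ↭-length (∼bag⇒↭ (unique∧set⇒bag u u′ h))

  ∈-boxes⁺ : ∀ {m} (ν ƛ : Vec ℕ m) {i j} → (ν / ƛ) (i , j) → (i , j) ∈ boxes ν ƛ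
  ∈-boxes⁺ {m} ν ƛ {i} {j} s = ∈-filter⁺ (ν /? ƛ)
    (∈-concatMap⁺ _ (Any.map (λ { refl → ∈-map⁺ (i ,_) (∈-upTo⁺ (proj₁ s)) }) (∈-allFin i))) s

  ∈-boxes⁻ : ∀ {m} (ν ƛ : Vec ℕ m) {a} → a ∈ boxes ν ƛ → (ν / ƛ) a
  ∈-boxes⁻ {m} ν ƛ a∈ =
    proj₂ (∈-filter⁻ (ν /? ƛ) {xs = concatMap (λ i → map (i ,_) (upTo (lookup ν i))) (allFin m)} a∈)

  size : ∀ {m} → Vec ℕ m → Vec ℕ m → ℕ
  size []      []      = 0
  size (l ∷ ƛ) (v ∷ ν) = v ∸ l + size ƛ ν

  length-concatMap : ∀ {A B : Set} (f : A → List B) xs →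
    length (concatMap f xs) ≡ ListAction.sum (map (length ∘ f) xs)
  length-concatMap f []       = refl
  length-concatMap f (x ∷ xs) = trans (length-++ (f x)) (cong (length (f x) +_) (length-concatMap f xs))

  filter-concatMap : ∀ {A B : Set} {P : B → Set} (P? : ∀ b → Dec (P b)) (f : A → List B) xs →
    filter P? (concatMap f xs) ≡ concatMap (filter P? ∘ f) xs
  filter-concatMap P? f []       = refl
  filter-concatMap P? f (x ∷ xs) =
    trans (filter-++ P? (f x) _) (cong (filter P? (f x) ++_) (filter-concatMap P? f xs))

  row-length : ∀ {m} (ν ƛ : Vec ℕ m) i →
    length (filter (ν /? ƛ) (map (i ,_) (upTo (lookup ν i)))) ≡ lookup ν i ∸ lookup ƛ i
  row-length ν ƛ i = trans
    (unique-length
      (Unique.filter⁺ (ν /? ƛ) (Unique.map⁺ (cong proj₂) (Unique.upTo⁺ v)))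
      (Unique.map⁺ {f = λ x → i , l + x} (ℕ.+-cancelˡ-≡ l _ _ ∘ cong proj₂) (Unique.upTo⁺ (v ∸ l)))
      (mk⇔ to from))
    (trans (length-map (λ x → i , l + x) (upTo (v ∸ l))) (length-upTo (v ∸ l)))
    where
    v = lookup ν i
    l = lookup ƛ i
    to : ∀ {a} → a ∈ filter (ν /? ƛ) (map (i ,_) (upTo v)) → a ∈ map (λ x → i , l + x) (upTo (v ∸ l))
    to a∈ with a∈′ , j<v , j≮l ← ∈-filter⁻ (ν /? ƛ) {xs = map (i ,_) (upTo v)} a∈
          with j , _ , refl ← ∈-map⁻ (i ,_) a∈′ =
      subst (λ x → (i , x) ∈ map (λ x → i , l + x) (upTo (v ∸ l))) (ℕ.m+[n∸m]≡n (ℕ.≮⇒≥ j≮l))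
        (∈-map⁺ (λ x → i , l + x) (∈-upTo⁺ (ℕ.∸-monoˡ-< {n = l} j<v (ℕ.≮⇒≥ j≮l))))
    from : ∀ {a} → a ∈ map (λ x → i , l + x) (upTo (v ∸ l)) → a ∈ filter (ν /? ƛ) (map (i ,_) (upTo v))
    from a∈ with x , x∈ , refl ← ∈-map⁻ (λ x → i , l + x) a∈ =
      ∈-filter⁺ (ν /? ƛ) (∈-map⁺ (i ,_) (∈-upTo⁺ l+x<v)) (l+x<v , ℕ.≤⇒≯ (ℕ.m≤m+n l x))
      where
      l+x<v : l + x < v
      l+x<v = ℕ.<-≤-trans (ℕ.+-monoʳ-< l (∈-upTo⁻ x∈)) (ℕ.≤-reflexive (ℕ.m+[n∸m]≡n {l} {v} (ℕ.<⇒≤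
        (ℕ.m∸n≢0⇒n<m {v} {l} (ℕ.m<n⇒n≢0 (∈-upTo⁻ x∈))))))

  sum-tabulate-size : ∀ {m} (ƛ ν : Vec ℕ m) → ListAction.sum (tabulate λ i → lookup ν i ∸ lookup ƛ i) ≡ size ƛ ν
  sum-tabulate-size []      []      = refl
  sum-tabulate-size (l ∷ ƛ) (v ∷ ν) = cong (v ∸ l +_) (sum-tabulate-size ƛ ν)

  ∣/∣≡size : ∀ {m} (ν ƛ : Vec ℕ m) → ∣ ν / ƛ ∣ ≡ size ƛ ν
  ∣/∣≡size {m} ν ƛ = begin
    length (filter (ν /? ƛ) (concatMap row (allFin m)))      ≡⟨ cong length (filter-concatMap (ν /? ƛ) row (allFin m)) ⟩
    length (concatMap (filter (ν /? ƛ) ∘ row) (allFin m))    ≡⟨ length-concatMap _ (allFin m) ⟩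
    ListAction.sum (map (length ∘ filter (ν /? ƛ) ∘ row) (allFin m))    ≡⟨ cong ListAction.sum (map-tabulate {n = m} (λ i → i) (length ∘ filter (ν /? ƛ) ∘ row)) ⟩
    ListAction.sum (tabulate (length ∘ filter (ν /? ƛ) ∘ row))          ≡⟨ cong ListAction.sum (tabulate-cong (row-length ν ƛ)) ⟩
    ListAction.sum (tabulate λ i → lookup ν i ∸ lookup ƛ i)             ≡⟨ sum-tabulate-size ƛ ν ⟩
    size ƛ ν                                                 ∎
    where
    open ≡-Reasoning
    row : Fin m → List (Box m)
    row i = map (i ,_) (upTo (lookup ν i))

  size-refl : ∀ {m} (ƛ : Vec ℕ m) → size ƛ ƛ ≡ 0
  size-refl []      = refl
  size-refl (l ∷ ƛ) = cong₂ _+_ (ℕ.n∸n≡0 l) (size-refl ƛ)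

  -- Each column counts once, and each step down counts the `v ∸ p` shared columns once more. One
  -- box of every overlap goes into d and the others go into e. The row above the chain is included.
  chain-size : ∀ {m p q d b e} {ƛ ν : Vec ℕ m} → Chain p q ƛ ν d b e → p < q → IsPartition (p ∷ ƛ) →
    (q ∸ p) + size ƛ ν ≡ (q ∸ b) + (e + d)
  chain-size {p = p} {q} {ƛ = ƛ} stop p<q pƛ = cong (q ∸ p +_) (size-refl ƛ)
  chain-size {p = p} {q} (step {l = l} {v} {d} {b} {e} {ƛ} {ν} p<v v≤q ch) p<q (l≤p ∷ pƛ) = begin
    (q ∸ p) + (v ∸ l + size ƛ ν)              ≡⟨ cong (q ∸ p +_) (chain-size ch (ℕ.≤-<-trans l≤p p<v) pƛ) ⟩
    (q ∸ p) + (v ∸ b + (e + d))               ≡⟨ ℕ.+-assoc (q ∸ p) (v ∸ b) (e + d) ⟨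
    (q ∸ p) + (v ∸ b) + (e + d)               ≡⟨ cong (_+ (e + d)) regroup ⟩
    (q ∸ b) + (v ∸ p) + (e + d)               ≡⟨ cong (λ x → (q ∸ b) + x + (e + d)) (ℕ.+-∸-assoc 1 p<v) ⟩
    (q ∸ b) + suc (v ∸ suc p) + (e + d)       ≡⟨ solve 4 (λ x y e d → x :+ (con 1 :+ y) :+ (e :+ d) :=
                                                   x :+ (y :+ e :+ (con 1 :+ d))) refl (q ∸ b) (v ∸ suc p) e d ⟩
    (q ∸ b) + (v ∸ suc p + e + suc d)         ∎
    where
    open ≡-Reasoning
    open +-*-Solver
    b≤p = ℕ.≤-trans (chain-bottom ch pƛ) l≤p
    split : ∀ {x y z} → x ≤ y → y ≤ z → z ∸ x ≡ (z ∸ y) + (y ∸ x)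
    split {x} {y} {z} x≤y y≤z = trans (cong (_∸ x) (sym (ℕ.m∸n+n≡m y≤z))) (ℕ.+-∸-assoc (z ∸ y) x≤y)
    -- Inclusion-exclusion: the column ranges from p to q and from b to v have the range from b to q
    -- as union and that from p to v as intersection.
    regroup : (q ∸ p) + (v ∸ b) ≡ (q ∸ b) + (v ∸ p)
    regroup = begin
      (q ∸ p) + (v ∸ b)               ≡⟨ cong (q ∸ p +_) (split b≤p (ℕ.<⇒≤ p<v)) ⟩
      (q ∸ p) + ((v ∸ p) + (p ∸ b))   ≡⟨ solve 3 (λ x y z → x :+ (y :+ z) := x :+ z :+ y) refl (q ∸ p) (v ∸ p) (p ∸ b) ⟩
      (q ∸ p) + (p ∸ b) + (v ∸ p)     ≡⟨ cong (_+ (v ∸ p)) (split b≤p (ℕ.<⇒≤ p<q)) ⟨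
      (q ∸ b) + (v ∸ p)               ∎

  strip-size : ∀ {m U t d b e} {ƛ ν : Vec ℕ m} → Strip U ƛ ν t d b e → IsPartition ƛ →
    size ƛ ν ≡ (t ∸ b) + (e + d)
  strip-size (here l<v _ ch)       pƛ = chain-size ch l<v pƛ
  strip-size (there {l = l} s)     pƛ = cong₂ _+_ (ℕ.n∸n≡0 l) (strip-size s (Linked.tail pƛ))

  chain-rows : ∀ {m p q d b e} {ƛ ν : Vec ℕ m} → Chain p q ƛ ν d b e → p < q → IsPartition (p ∷ ƛ) →
    ∃[ rs ] Unique rs × length rs ≡ suc d × (∀ i → i ∈ rs ⇔ lookup (p ∷ ƛ) i < lookup (q ∷ ν) i)
  chain-rows {p = p} {q} {ƛ = ƛ} stop p<q _ = zero ∷ [] , [] ∷ [] , refl , λ i → mk⇔ (λ { (here refl) → p<q }) (from i)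
    where
    from : ∀ i → lookup (p ∷ ƛ) i < lookup (q ∷ ƛ) i → i ∈ zero ∷ []
    from zero    _   = here refl
    from (suc i) l<l = contradiction l<l (ℕ.<-irrefl refl)
  chain-rows {p = p} {q} (step {l = l} {v} {ƛ = ƛ} {ν} p<v v≤q ch) p<q (l≤p ∷ pƛ)
    with rs , u , len , h ← chain-rows ch (ℕ.≤-<-trans l≤p p<v) pƛ =
    zero ∷ map suc rs , All.tabulate zero∉ ∷ Unique.map⁺ Fin.suc-injective u ,
    cong suc (trans (length-map suc rs) len) , λ i → mk⇔ (to i) (from i)
    where
    zero∉ : ∀ {i} → i ∈ map suc rs → zero ≢ i
    zero∉ i∈ 0≡i with _ , _ , eq ← ∈-map⁻ suc i∈ = contradiction (trans 0≡i eq) λ ()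
    to : ∀ i → i ∈ zero ∷ map suc rs → lookup (p ∷ l ∷ ƛ) i < lookup (q ∷ v ∷ ν) i
    to i (here refl) = p<q
    to i (there i∈) with i′ , i′∈ , refl ← ∈-map⁻ suc i∈ = Equivalence.to (h i′) i′∈
    from : ∀ i → lookup (p ∷ l ∷ ƛ) i < lookup (q ∷ v ∷ ν) i → i ∈ zero ∷ map suc rs
    from zero    _   = here refl
    from (suc i) l<v = there (∈-map⁺ suc (Equivalence.from (h i) l<v))

  strip-rows : ∀ {m U t d b e} {ƛ ν : Vec ℕ m} → Strip U ƛ ν t d b e → IsPartition ƛ →
    ∃[ rs ] Unique rs × length rs ≡ suc d × (∀ i → i ∈ rs ⇔ lookup ƛ i < lookup ν i)
  strip-rows (here l<v _ ch) pƛ = chain-rows ch l<v pƛ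
  strip-rows (there {l = l} {ƛ = ƛ} {ν} s) pƛ with rs , u , len , h ← strip-rows s (Linked.tail pƛ) =
    map suc rs , Unique.map⁺ Fin.suc-injective u , trans (length-map suc rs) len , λ i → mk⇔ (to i) (from i)
    where
    to : ∀ i → i ∈ map suc rs → lookup (l ∷ ƛ) i < lookup (l ∷ ν) i
    to i i∈ with i′ , i′∈ , refl ← ∈-map⁻ suc i∈ = Equivalence.to (h i′) i′∈
    from : ∀ i → lookup (l ∷ ƛ) i < lookup (l ∷ ν) i → i ∈ map suc rs
    from zero    l<l = contradiction l<l (ℕ.<-irrefl refl)
    from (suc i) l<v = ∈-map⁺ suc (Equivalence.from (h i) l<v)

  chain-column⁻ : ∀ {m p q d b e} {ƛ ν : Vec ℕ m} → Chain p q ƛ ν d b e → IsPartition (p ∷ ƛ) →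
    ∀ i {j} → ((q ∷ ν) / (p ∷ ƛ)) (i , j) → b ≤ j × j < q
  chain-column⁻ ch pƛ zero (j<q , j≮p) = ℕ.≤-trans (chain-bottom ch pƛ) (ℕ.≮⇒≥ j≮p) , j<q
  chain-column⁻ stop pƛ (suc i) (j<l , j≮l) = contradiction j<l j≮l
  chain-column⁻ (step p<v v≤q ch) (l≤p ∷ pƛ) (suc i) s with b≤j , j<v ← chain-column⁻ ch pƛ i s =
    b≤j , ℕ.<-≤-trans j<v v≤q

  -- No column is missing because successive rows overlap: a column not reached by the next row,
  -- which ends at `v`, lies to the right of p and hence in the top row.
  chain-column⁺ : ∀ {m p q d b e} {ƛ ν : Vec ℕ m} → Chain p q ƛ ν d b e →
    ∀ {j} → b ≤ j → j < q → ∃[ i ] ((q ∷ ν) / (p ∷ ƛ)) (i , j)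
  chain-column⁺ stop b≤j j<q = zero , j<q , ℕ.≤⇒≯ b≤j
  chain-column⁺ (step {v = v} p<v v≤q ch) {j} b≤j j<q with j ℕ.<? v
  ... | yes j<v with i , s ← chain-column⁺ ch b≤j j<v = suc i , s
  ... | no j≮v = zero , j<q , ℕ.≤⇒≯ (ℕ.≤-trans (ℕ.<⇒≤ p<v) (ℕ.≮⇒≥ j≮v))

  strip-column⁻ : ∀ {m U t d b e} {ƛ ν : Vec ℕ m} → Strip U ƛ ν t d b e → IsPartition ƛ →
    ∀ i {j} → (ν / ƛ) (i , j) → b ≤ j × j < t
  strip-column⁻ (here _ _ ch) pƛ i       s           = chain-column⁻ ch pƛ i s
  strip-column⁻ (there s)     pƛ zero    (j<l , j≮l) = contradiction j<l j≮l
  strip-column⁻ (there s)     pƛ (suc i) s′          = strip-column⁻ s (Linked.tail pƛ) i s′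

  strip-column⁺ : ∀ {m U t d b e} {ƛ ν : Vec ℕ m} → Strip U ƛ ν t d b e →
    ∀ {j} → b ≤ j → j < t → ∃[ i ] (ν / ƛ) (i , j)
  strip-column⁺ (here _ _ ch) b≤j j<t = chain-column⁺ ch b≤j j<t
  strip-column⁺ (there s)     b≤j j<t with i , s′ ← strip-column⁺ s b≤j j<t = suc i , s′

  r≡ : ∀ {m U t d b e} {ƛ ν : Vec ℕ m} → Strip U ƛ ν t d b e → IsPartition ƛ → r[ ν / ƛ ] ≡ suc d
  r≡ {ƛ = ƛ} {ν} s pƛ with rs , u , len , h ← strip-rows s pƛ = trans
    (unique-length (DecUnique.deduplicate-! Fin._≟_ (map proj₁ (boxes ν ƛ))) u (mk⇔ to from)) len
    where
    to : ∀ {i} → i ∈ deduplicate Fin._≟_ (map proj₁ (boxes ν ƛ)) → i ∈ rs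
    to {i} i∈ with (_ , j) , a∈ , refl ← ∈-map⁻ proj₁ (∈-deduplicate⁻ Fin._≟_ (map proj₁ (boxes ν ƛ)) i∈)
              with j<v , j≮l ← ∈-boxes⁻ ν ƛ a∈ =
      Equivalence.from (h i) (ℕ.≤-<-trans (ℕ.≮⇒≥ j≮l) j<v)
    from : ∀ {i} → i ∈ rs → i ∈ deduplicate Fin._≟_ (map proj₁ (boxes ν ƛ))
    from {i} i∈ = ∈-deduplicate⁺ Fin._≟_ (∈-map⁺ proj₁ (∈-boxes⁺ ν ƛ
      (Equivalence.to (h i) i∈ , ℕ.<-irrefl refl)))

  c≡ : ∀ {m U t d b e} {ƛ ν : Vec ℕ m} → Strip U ƛ ν t d b e → IsPartition ƛ → c[ ν / ƛ ] ≡ t ∸ b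
  c≡ {t = t} {b = b} {ƛ = ƛ} {ν} s pƛ = trans
    (unique-length (DecUnique.deduplicate-! ℕ._≟_ (map proj₂ (boxes ν ƛ)))
      (Unique.map⁺ (ℕ.+-cancelˡ-≡ b _ _) (Unique.upTo⁺ (t ∸ b))) (mk⇔ to from))
    (trans (length-map (b +_) (upTo (t ∸ b))) (length-upTo (t ∸ b)))
    where
    b≤t = ℕ.<⇒≤ (strip-<-top s pƛ)
    to : ∀ {j} → j ∈ deduplicate ℕ._≟_ (map proj₂ (boxes ν ƛ)) → j ∈ map (b +_) (upTo (t ∸ b))
    to {j} j∈ with (i , _) , a∈ , refl ← ∈-map⁻ proj₂ (∈-deduplicate⁻ ℕ._≟_ (map proj₂ (boxes ν ƛ)) j∈)
              with b≤j , j<t ← strip-column⁻ s pƛ i (∈-boxes⁻ ν ƛ a∈) =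
      subst (_∈ map (b +_) (upTo (t ∸ b))) (ℕ.m+[n∸m]≡n b≤j)
        (∈-map⁺ (b +_) (∈-upTo⁺ (ℕ.∸-monoˡ-< {n = b} j<t b≤j)))
    from : ∀ {j} → j ∈ map (b +_) (upTo (t ∸ b)) → j ∈ deduplicate ℕ._≟_ (map proj₂ (boxes ν ƛ))
    from j∈ with x , x∈ , refl ← ∈-map⁻ (b +_) j∈
            with i , s′ ← strip-column⁺ s (ℕ.m≤m+n b x)
                   (ℕ.<-≤-trans (ℕ.+-monoʳ-< b (∈-upTo⁻ x∈)) (ℕ.≤-reflexive (ℕ.m+[n∸m]≡n b≤t))) =
      ∈-deduplicate⁺ ℕ._≟_ (∈-map⁺ proj₂ (∈-boxes⁺ ν ƛ s′))

  -- Connectedness and ribbons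

  Step : ∀ {m} → Shape m → Box m → Box m → Set
  Step S a b = S a × S b × Adjacent a b

  Step-sym : ∀ {m} {S : Shape m} {a b} → Step S a b → Step S b a
  Step-sym {a = i , j} {i′ , j′} (s , s′ , inj₁ (i≡ , j~)) =
    s′ , s , inj₁ (sym i≡ , trans (ℕ.∣-∣-comm j′ j) j~)
  Step-sym {a = i , j} {i′ , j′} (s , s′ , inj₂ (i~ , j≡)) =
    s′ , s , inj₂ (trans (ℕ.∣-∣-comm (toℕ i′) (toℕ i)) i~ , sym j≡)

  ∣1+n-n∣≡1 : ∀ n → ∣ suc n - n ∣ ≡ 1
  ∣1+n-n∣≡1 zero    = refl
  ∣1+n-n∣≡1 (suc n) = ∣1+n-n∣≡1 n

  row-walk : ∀ {m} (ν ƛ : Vec ℕ m) i {j₀ j} → lookup ƛ i ≤ j₀ → j₀ ≤ j → j < lookup ν i →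
    Star (Step (ν / ƛ)) (i , j) (i , j₀)
  row-walk ν ƛ i {j₀} {j} l≤j₀ j₀≤j j<v with ℕ.m≤n⇒m<n∨m≡n j₀≤j
  ... | inj₂ refl = ε
  row-walk ν ƛ i {j₀} {suc j} l≤j₀ j₀≤j j<v | inj₁ (s≤s j₀≤j′) =
    ((j<v , ℕ.≤⇒≯ (ℕ.≤-trans l≤j₀ j₀≤j)) , (ℕ.<-trans (ℕ.n<1+n j) j<v , ℕ.≤⇒≯ (ℕ.≤-trans l≤j₀ j₀≤j′)) ,
      inj₁ (refl , ∣1+n-n∣≡1 j))
    ◅ row-walk ν ƛ i l≤j₀ j₀≤j′ (ℕ.<-trans (ℕ.n<1+n j) j<v)

  lower : ∀ {m} → Box m → Box (suc m)
  lower (i , j) = suc i , j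

  lower-path : ∀ {m l v} {ƛ ν : Vec ℕ m} {a b} → Star (Step (ν / ƛ)) a b →
    Star (Step ((v ∷ ν) / (l ∷ ƛ))) (lower a) (lower b)
  lower-path = gmap lower λ { (s , s′ , inj₁ (refl , j~)) → s , s′ , inj₁ (refl , j~)
                            ; (s , s′ , inj₂ adj)         → s , s′ , inj₂ adj }

  -- The first box of the top row serves as a common target. From the first box of the next row one
  -- walks right to column p, which that row contains since p < v, and then up.
  chain-path : ∀ {m p q d b e} {ƛ ν : Vec ℕ m} → Chain p q ƛ ν d b e → p < q → IsPartition (p ∷ ƛ) →
    ∀ i {j} → ((q ∷ ν) / (p ∷ ƛ)) (i , j) → Star (Step ((q ∷ ν) / (p ∷ ƛ))) (i , j) (zero , p)
  chain-path {p = p} {q} {ƛ = ƛ} {ν} ch p<q pƛ zero (j<q , j≮p) =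
    row-walk (q ∷ ν) (p ∷ ƛ) zero ℕ.≤-refl (ℕ.≮⇒≥ j≮p) j<q
  chain-path stop p<q pƛ (suc i) (j<l , j≮l) = contradiction j<l j≮l
  chain-path {p = p} {q} (step {l = l} {v} {ƛ = ƛ} {ν} p<v v≤q ch) p<q (l≤p ∷ pƛ) (suc i) s =
    lower-path (chain-path ch (ℕ.≤-<-trans l≤p p<v) pƛ i s)
    ◅◅ reverse Step-sym (row-walk (q ∷ v ∷ ν) (p ∷ l ∷ ƛ) (suc zero) ℕ.≤-refl l≤p p<v)
    ◅◅ (((p<v , ℕ.≤⇒≯ l≤p) , (p<q , ℕ.<-irrefl refl) , inj₂ (refl , refl)) ◅ ε)

  strip-connected : ∀ {m U t d b e} {ƛ ν : Vec ℕ m} → Strip U ƛ ν t d b e → IsPartition ƛ →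
    Connected (ν / ƛ)
  strip-connected (here l<v _ ch) pƛ (i , _) (i′ , _) s s′ =
    chain-path ch l<v pƛ i s ◅◅ reverse Step-sym (chain-path ch l<v pƛ i′ s′)
  strip-connected (there st) pƛ (zero , _)  _            (j<l , j≮l) _  = contradiction j<l j≮l
  strip-connected (there st) pƛ (suc _ , _) (zero , _)   _ (j<l , j≮l)  = contradiction j<l j≮l
  strip-connected (there st) pƛ (suc i , j) (suc i′ , j′) s s′ =
    lower-path (strip-connected st (Linked.tail pƛ) (i , j) (i′ , j′) s s′)

  -- A path from the rows up to t to the rows from t′ on has to step from a box of row t to the box
  -- below it.
  Overlapping : ∀ {m} → Vec ℕ m → Vec ℕ m → Set
  Overlapping {m} ν ƛ = ∀ (t t′ : Fin m) → toℕ t′ ≡ suc (toℕ t) → ∀ {a b} → (ν / ƛ) a → (ν / ƛ) b →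
    toℕ (proj₁ a) ≤ toℕ t → toℕ t < toℕ (proj₁ b) → lookup ƛ t < lookup ν t′

  connected⇒overlapping : ∀ {m} {ν ƛ : Vec ℕ m} → Connected (ν / ƛ) → Overlapping ν ƛ
  connected⇒overlapping {m} {ν} {ƛ} conn t t′ t′≡ {a} {b} sa sb a≤t t<b = go (conn a b sa sb) a≤t
    where
    go : ∀ {a} → Star (Step (ν / ƛ)) a b → toℕ (proj₁ a) ≤ toℕ t → lookup ƛ t < lookup ν t′
    go ε a≤t = contradiction a≤t (ℕ.<⇒≱ t<b)
    go {i , j} (_◅_ {j = i′ , _} (s , s′ , adj) path) i≤t with toℕ i′ ℕ.≤? toℕ t
    ... | yes i′≤t = go path i′≤t
    ... | no i′≰t with adj
    ... | inj₁ (refl , _) = contradiction i≤t i′≰t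
    ... | inj₂ (i~i′ , refl) = subst₂ (λ t t′ → lookup ƛ t < lookup ν t′)
        (Fin.toℕ-injective i≡t) (Fin.toℕ-injective (trans i′≡ (trans (cong suc i≡t) (sym t′≡))))
        (ℕ.≤-<-trans (ℕ.≮⇒≥ (proj₂ s)) (proj₁ s′))
      where
      i<i′ = ℕ.≤-<-trans i≤t (ℕ.≰⇒> i′≰t)
      i′≡ : toℕ i′ ≡ suc (toℕ i)
      i′≡ = trans (sym (ℕ.m∸n+n≡m (ℕ.<⇒≤ i<i′)))
        (cong (_+ toℕ i) (trans (sym (ℕ.m≤n⇒∣m-n∣≡n∸m (ℕ.<⇒≤ i<i′))) i~i′))
      i≡t : toℕ i ≡ toℕ t
      i≡t = ℕ.≤-antisym i≤t (ℕ.s≤s⁻¹ (ℕ.≤-trans (ℕ.≰⇒> i′≰t) (ℕ.≤-reflexive i′≡)))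

  overlapping-tail : ∀ {m l v} {ν ƛ : Vec ℕ m} → Overlapping (v ∷ ν) (l ∷ ƛ) → Overlapping ν ƛ
  overlapping-tail ov t t′ t′≡ {a} {b} sa sb a≤t t<b =
    ov (suc t) (suc t′) (cong suc t′≡) {lower a} {lower b} sa sb (s≤s a≤t) (s≤s t<b)

  ⊆-antisym : ∀ {m} {ƛ ν : Vec ℕ m} → ƛ ⊆ ν → ν ⊆ ƛ → ƛ ≡ ν
  ⊆-antisym {ƛ = []}    {[]}    _ _ = refl
  ⊆-antisym {ƛ = l ∷ ƛ} {v ∷ ν} h h′ =
    cong₂ _∷_ (ℕ.≤-antisym (h zero) (h′ zero)) (⊆-antisym (h ∘ suc) (h′ ∘ suc))

  overlapping⇒chain : ∀ {m p q} {ƛ ν : Vec ℕ m} → Overlapping (q ∷ ν) (p ∷ ƛ) → p < q →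
    IsPartition (p ∷ ƛ) → IsPartition (q ∷ ν) → ƛ ⊆ ν → ∃[ d ] ∃[ b ] ∃[ e ] Chain p q ƛ ν d b e
  overlapping⇒chain {ƛ = []} {[]} ov p<q pƛ pν ƛ⊆ν = _ , _ , _ , stop
  overlapping⇒chain {p = p} {q} {l ∷ ƛ} {v ∷ ν} ov p<q (l≤p ∷ pƛ) (v≤q ∷ pν) ƛ⊆ν with p ℕ.<? v
  ... | yes p<v with _ , _ , _ , ch ← overlapping⇒chain (overlapping-tail ov) (ℕ.≤-<-trans l≤p p<v) pƛ pν (ƛ⊆ν ∘ suc) =
    _ , _ , _ , step p<v v≤q ch
  -- A box in any lower row, connected with the box `(zero , p)`, would force p < v; so nothing
  -- below has changed.
  ... | no p≮v with refl ← ⊆-antisym {ƛ = l ∷ ƛ} {v ∷ ν} ƛ⊆ν (λ i → ℕ.≮⇒≥ λ l<v → p≮v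
      (ov zero (suc zero) refl {zero , p} {suc i , lookup (l ∷ ƛ) i}
        (p<q , ℕ.<-irrefl refl) (l<v , ℕ.<-irrefl refl) z≤n (s≤s z≤n))) = _ , _ , _ , stop

  overlapping⇒strip : ∀ {m U} {ƛ ν : Vec ℕ m} → Overlapping ν ƛ → IsPartition ƛ → IsPartition (U ∷ ν) →
    ƛ ⊆ ν → ∀ i → lookup ƛ i < lookup ν i → ∃[ t ] ∃[ d ] ∃[ b ] ∃[ e ] Strip U ƛ ν t d b e
  overlapping⇒strip {ƛ = l ∷ ƛ} {v ∷ ν} ov pƛ (v≤U ∷ pν) ƛ⊆ν i l<v with ℕ.m≤n⇒m<n∨m≡n (ƛ⊆ν zero)
  ... | inj₁ l₀<v₀ with _ , _ , _ , ch ← overlapping⇒chain ov l₀<v₀ pƛ pν (ƛ⊆ν ∘ suc) =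
    _ , _ , _ , _ , here l₀<v₀ v≤U ch
  overlapping⇒strip ov pƛ (v≤U ∷ pν) ƛ⊆ν zero    l<v | inj₂ refl = contradiction l<v (ℕ.<-irrefl refl)
  overlapping⇒strip ov pƛ (v≤U ∷ pν) ƛ⊆ν (suc i) l<v | inj₂ refl
    with _ , _ , _ , _ , s ← overlapping⇒strip (overlapping-tail ov) (Linked.tail pƛ) pν (ƛ⊆ν ∘ suc) i l<v =
    _ , _ , _ , _ , there s

  -- hull U ƛ ν / ƛ is the maximal ribbon along the northwest border if U bounds ν: a row may overlap
  -- the row above it, which starts in column p, in one box only.
  hull : ∀ {m} → ℕ → Vec ℕ m → Vec ℕ m → Vec ℕ m
  hull p []      []      = []
  hull p (l ∷ ƛ) (v ∷ ν) = v ⊓ suc p ∷ hull l ƛ ν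

  hull-⊆ : ∀ {m} p (ƛ ν : Vec ℕ m) → hull p ƛ ν ⊆ ν
  hull-⊆ p (l ∷ ƛ) (v ∷ ν) zero    = ℕ.m⊓n≤m v (suc p)
  hull-⊆ p (l ∷ ƛ) (v ∷ ν) (suc i) = hull-⊆ l ƛ ν i

  hull-self : ∀ {m p} {ƛ : Vec ℕ m} → IsPartition (p ∷ ƛ) → hull p ƛ ƛ ≡ ƛ
  hull-self {ƛ = []}    _          = refl
  hull-self {ƛ = l ∷ ƛ} (l≤p ∷ pƛ) = cong₂ _∷_ (ℕ.m≤n⇒m⊓n≡m (ℕ.m≤n⇒m≤1+n l≤p)) (hull-self pƛ)

  -- Every overlap is cut down to a single box, which makes e vanish but keeps the rows and the
  -- lowest starting column. The row above has been cut as well, hence its new end `q′`.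
  hull-chain : ∀ {m p q q′ d b e} {ƛ ν : Vec ℕ m} → Chain p q ƛ ν d b e → p < q′ →
    IsPartition (p ∷ ƛ) → Chain p q′ ƛ (hull p ƛ ν) d b 0
  hull-chain stop p<q′ pƛ rewrite hull-self pƛ = stop
  hull-chain {p = p} {q′ = q′} (step {l = l} {v} {d} {b} {ƛ = ƛ} {ν} p<v v≤q ch) p<q′ (l≤p ∷ pƛ)
    rewrite ℕ.m≥n⇒m⊓n≡n p<v =
    subst (Chain p q′ (l ∷ ƛ) (suc p ∷ hull l ƛ ν) (suc d) b) (trans (ℕ.+-identityʳ _) (ℕ.n∸n≡0 (suc p)))
      (step ℕ.≤-refl p<q′ (hull-chain ch (s≤s l≤p) pƛ))

  hull-strip : ∀ {m U t d b e} {ƛ ν : Vec ℕ m} → Strip U ƛ ν t d b e → IsPartition (U ∷ ƛ) →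
    Strip U ƛ (hull U ƛ ν) t d b 0
  hull-strip (here l<v v≤U ch) (_ ∷ pƛ)   rewrite ℕ.m≤n⇒m⊓n≡m (ℕ.m≤n⇒m≤1+n v≤U) =
    here l<v v≤U (hull-chain ch l<v pƛ)
  hull-strip (there s)         (l≤U ∷ pƛ) rewrite ℕ.m≤n⇒m⊓n≡m (ℕ.m≤n⇒m≤1+n l≤U) =
    there (hull-strip s pƛ)

  hull-overlap : ∀ {m} p (ƛ ν : Vec ℕ m) i i′ → toℕ i′ ≡ suc (toℕ i) →
    lookup (hull p ƛ ν) i′ ≤ suc (lookup ƛ i)
  hull-overlap p (l ∷ l′ ∷ ƛ) (v ∷ v′ ∷ ν) zero (suc zero) _ = ℕ.m⊓n≤n v′ (suc l)
  hull-overlap p (l ∷ ƛ) (v ∷ ν) (suc i) (suc i′) eq = hull-overlap l ƛ ν i i′ (ℕ.suc-injective eq)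

  hull-no2×2 : ∀ {m} p (ƛ ν : Vec ℕ m) → ¬ Contains2×2 (hull p ƛ ν / ƛ)
  hull-no2×2 p ƛ ν (i , i′ , j , i′≡ , (_ , j≮l) , _ , _ , (1+j<v , _)) =
    j≮l (ℕ.s≤s⁻¹ (ℕ.≤-trans 1+j<v (hull-overlap p ƛ ν i i′ i′≡)))

  no2×2-tail : ∀ {m l v} {ν ƛ : Vec ℕ m} → ¬ Contains2×2 ((v ∷ ν) / (l ∷ ƛ)) → ¬ Contains2×2 (ν / ƛ)
  no2×2-tail h (i , i′ , j , i′≡ , s) = h (suc i , suc i′ , j , cong suc i′≡ , s)

  partition-bounded : ∀ {m U} {ƛ : Vec ℕ m} → IsPartition (U ∷ ƛ) → ∀ i → lookup ƛ i ≤ U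
  partition-bounded {ƛ = _ ∷ _} (l≤U ∷ p) zero    = l≤U
  partition-bounded {ƛ = _ ∷ _} (l≤U ∷ p) (suc i) = ℕ.≤-trans (partition-bounded p i) l≤U

  -- If a row of μ reached beyond l + 1, where the row above starts in column l, the columns l and l
  -- + 1 of these two rows would form a square.
  ribbon-⊆-hull : ∀ {m p} {ƛ ν μ : Vec ℕ m} → IsPartition ƛ → IsPartition μ → ¬ Contains2×2 (μ / ƛ) →
    μ ⊆ ν → (∀ i → lookup μ i ≤ suc p) → μ ⊆ hull p ƛ ν
  ribbon-⊆-hull {ƛ = l ∷ ƛ} {v ∷ ν} {w ∷ μ} pƛ pμ h μ⊆ν μ≤ zero = ℕ.⊓-glb (μ⊆ν zero) (μ≤ zero)
  ribbon-⊆-hull {ƛ = l ∷ l′ ∷ ƛ} {v ∷ ν} {w ∷ w′ ∷ μ} (l′≤l ∷ pƛ) (w′≤w ∷ pμ) h μ⊆ν μ≤ (suc i) =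
    ribbon-⊆-hull {ν = ν} pƛ pμ (no2×2-tail h) (μ⊆ν ∘ suc) (λ i → ℕ.≤-trans (bounded i) w′≤1+l) i
    where
    bounded : ∀ i → lookup (w′ ∷ μ) i ≤ w′
    bounded zero    = ℕ.≤-refl
    bounded (suc i) = partition-bounded pμ i
    w′≤1+l : w′ ≤ suc l
    w′≤1+l = ℕ.≮⇒≥ λ 1+l<w′ → let l<w′ = ℕ.<-trans (ℕ.n<1+n l) 1+l<w′ in
      h (zero , suc zero , l , refl
        , (ℕ.<-≤-trans l<w′ w′≤w , ℕ.<-irrefl refl)
        , (ℕ.<-≤-trans 1+l<w′ w′≤w , ℕ.≤⇒≯ (ℕ.n≤1+n l))
        , (l<w′ , ℕ.≤⇒≯ l′≤l)
        , (1+l<w′ , ℕ.≤⇒≯ (ℕ.m≤n⇒m≤1+n l′≤l)))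

  size-mono : ∀ {m} {ƛ μ ν : Vec ℕ m} → μ ⊆ ν → size ƛ μ ≤ size ƛ ν
  size-mono {ƛ = []}    {[]}    {[]}    h = z≤n
  size-mono {ƛ = l ∷ ƛ} {w ∷ μ} {v ∷ ν} h = ℕ.+-mono-≤ (ℕ.∸-monoˡ-≤ l (h zero)) (size-mono {ƛ = ƛ} (h ∘ suc))

  size-positive : ∀ {m} (ƛ ν : Vec ℕ m) → 0 < size ƛ ν → ∃[ i ] lookup ƛ i < lookup ν i
  size-positive []      []      ()
  size-positive (l ∷ ƛ) (v ∷ ν) 0<size with l ℕ.<? v
  ... | yes l<v = zero , l<v
  ... | no l≮v with i , l<v ← size-positive ƛ ν
        (ℕ.<-≤-trans 0<size (ℕ.≤-reflexive (cong (_+ size ƛ ν) (ℕ.m≤n⇒m∸n≡0 (ℕ.≮⇒≥ l≮v))))) = suc i , l<v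

  module _ {m U t d b e} {ƛ ν : Vec ℕ m} (s : Strip U ƛ ν t d b e) (pUƛ : IsPartition (U ∷ ƛ)) where

    private
      pƛ = Linked.tail pUƛ
      μ  = hull U ƛ ν
      sμ = hull-strip s pUƛ

    hull-size : size ƛ μ ≡ (t ∸ b) + d
    hull-size = strip-size sμ pƛ

    ribbon-size : ∀ {μ′} → NWRibbon ν ƛ μ′ → ∣ μ′ / ƛ ∣ ≤ (t ∸ b) + d
    ribbon-size {μ′} rib = ℕ.≤-trans (ℕ.≤-reflexive (∣/∣≡size μ′ ƛ)) (ℕ.≤-trans
      (size-mono {ƛ = ƛ} (ribbon-⊆-hull pƛ isPartition (proj₂ isRibbon) upper
        λ i → ℕ.m≤n⇒m≤1+n (ℕ.≤-trans (upper i) (partition-bounded (strip-partition s pUƛ) i))))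
      (ℕ.≤-reflexive hull-size))
      where open NWRibbon rib

    hull-maximal : MaximalNWRibbon ν ƛ μ
    hull-maximal = record
      { nwRibbon = record
        { isPartition = Linked.tail (strip-partition sμ pUƛ)
        ; lower       = strip-⊆ sμ pƛ
        ; upper       = hull-⊆ U ƛ ν
        ; isRibbon    = strip-connected sμ pƛ , hull-no2×2 U ƛ ν
        }
      ; largest = λ μ′ rib → ℕ.≤-trans (ribbon-size rib)
          (ℕ.≤-reflexive (sym (trans (∣/∣≡size μ ƛ) hull-size)))
      }

    strip⇒admissible : ∀ {k} → Window k t d b → Admissible k ƛ ν
    strip⇒admissible (c≤k , k≤) = record
      { isPartition = Linked.tail (strip-partition s pUƛ)
      ; ƛ⊆ν         = strip-⊆ s pƛ
      ; columns     = ℕ.≤-trans (ℕ.≤-reflexive (c≡ s pƛ)) c≤k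
      ; connected   = strip-connected s pƛ
      ; ribbon      = μ , hull-maximal , ℕ.≤-trans k≤ (ℕ.≤-reflexive (sym (trans (∣/∣≡size μ ƛ) hull-size)))
      }

  -- As k ≥ 1, the maximal ribbon and with it ν / λ is nonempty. The first column b is at most some
  -- entry of λ and there are at most k columns, so t ≤ b + k ≤ U: the enumeration up to `U` loses
  -- no ν.
  admissible⇒strip : ∀ {m k U} {ƛ ν : Vec ℕ m} → 1 ≤ k → IsPartition ƛ → (∀ i → lookup ƛ i + k ≤ U) →
    Admissible k ƛ ν → ∃[ t ] ∃[ d ] ∃[ b ] ∃[ e ] Strip U ƛ ν t d b e × Window k t d b
  admissible⇒strip {k = k} {U} {ƛ} {ν} 1≤k pƛ bound adm = result
    where
    open Admissible adm
    above : ∀ {m} {ν : Vec ℕ m} → IsPartition ν → ∃[ U ] IsPartition (U ∷ ν)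
    above {ν = []}    _ = 0 , [-]
    above {ν = v ∷ ν} p = v , ℕ.≤-refl ∷ p
    extend : ∀ {m U} {ƛ ν : Vec ℕ m} → IsPartition ƛ → ƛ ⊆ ν → IsPartition (U ∷ ν) → IsPartition (U ∷ ƛ)
    extend {ƛ = []}    p h pU = [-]
    extend {ƛ = l ∷ ƛ} {v ∷ ν} p h (v≤U ∷ _) = ℕ.≤-trans (h zero) v≤U ∷ p
    bottom≤ : ∀ {m U t d b e} {ƛ ν : Vec ℕ m} → Strip U ƛ ν t d b e → IsPartition ƛ → ∃[ i ] b ≤ lookup ƛ i
    bottom≤ (here _ _ ch) p = zero , chain-bottom ch p
    bottom≤ (there s)     p with i , b≤ ← bottom≤ s (Linked.tail p) = suc i , b≤
    result : ∃[ t ] ∃[ d ] ∃[ b ] ∃[ e ] Strip U ƛ ν t d b e × Window k t d b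
    result with V , pV ← above isPartition | μ , max , k≤ ← ribbon
      with i , l<v ← size-positive ƛ ν (ℕ.≤-trans 1≤k (ℕ.≤-trans k≤ (ℕ.≤-trans
             (ℕ.≤-reflexive (∣/∣≡size μ ƛ)) (size-mono {ƛ = ƛ} (NWRibbon.upper (MaximalNWRibbon.nwRibbon max))))))
      with t , d , b , e , s ← overlapping⇒strip (connected⇒overlapping {ν = ν} {ƛ} connected) pƛ pV ƛ⊆ν i l<v
      with i′ , b≤ ← bottom≤ s pƛ =
      t , d , b , e , strip-rebound s t≤U , c≤k ,
        ℕ.≤-trans k≤ (ribbon-size s (extend pƛ ƛ⊆ν pV) (MaximalNWRibbon.nwRibbon max))
      where
      c≤k : t ∸ b ≤ k
      c≤k = ℕ.≤-trans (ℕ.≤-reflexive (sym (c≡ s pƛ))) columns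
      t≤U : t ≤ U
      t≤U = ℕ.≤-trans (ℕ.m≤n+m∸n t b) (ℕ.≤-trans (ℕ.+-mono-≤ b≤ c≤k) (bound i′))
  partition-bound : ∀ {m} k (ƛ : Vec ℕ m) → IsPartition ƛ →
    ∃[ U ] IsPartition (U ∷ ƛ) × (∀ i → lookup ƛ i + k ≤ U)
  partition-bound k []      p = 0 , [-] , λ ()
  partition-bound k (l ∷ ƛ) p = l + k , ℕ.m≤m+n l k ∷ p , λ
    { zero    → ℕ.≤-refl
    ; (suc i) → ℕ.+-monoˡ-≤ k (partition-bounded p i) }

open SkewShapes

-- Determinants

data Neighbours : ∀ {m} → Fin m → Fin m → Set where
  first : ∀ {m} → Neighbours {suc (suc m)} zero (suc zero)
  next  : ∀ {m} {i j : Fin m} → Neighbours i j → Neighbours (suc i) (suc j)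

toℕ-neighbours : ∀ {m} {i j : Fin m} → Neighbours i j → toℕ j ≡ suc (toℕ i)
toℕ-neighbours first    = ≡.refl
toℕ-neighbours (next a) = ≡.cong suc (toℕ-neighbours a)

punchIn-neighbours : ∀ {m} {i j : Fin (suc m)} → Neighbours i j → ∀ k →
  punchIn i k ≡ punchIn j k ⊎ (punchIn i k ≡ j × punchIn j k ≡ i)
punchIn-neighbours first    zero    = inj₂ (≡.refl , ≡.refl)
punchIn-neighbours first    (suc k) = inj₁ ≡.refl
punchIn-neighbours {suc m} (next a) zero = inj₁ ≡.refl
punchIn-neighbours {suc m} (next a) (suc k) with punchIn-neighbours a k
... | inj₁ eq        = inj₁ (≡.cong suc eq)
... | inj₂ (eq , eq′) = inj₂ (≡.cong suc eq , ≡.cong suc eq′)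

neighbours-punchIn : ∀ {m} {i j : Fin (suc m)} → Neighbours i j → ∀ p → p ≢ i → p ≢ j →
  ∃[ i′ ] ∃[ j′ ] Neighbours i′ j′ × punchIn p i′ ≡ i × punchIn p j′ ≡ j
neighbours-punchIn first zero p≢i _ = contradiction ≡.refl p≢i
neighbours-punchIn first (suc zero) _ p≢j = contradiction ≡.refl p≢j
neighbours-punchIn {suc (suc m)} first (suc (suc p)) _ _ =
  zero , suc zero , first , ≡.refl , ≡.refl
neighbours-punchIn {suc m} (next {i = i} {j} a) zero _ _ = i , j , a , ≡.refl , ≡.refl
neighbours-punchIn {suc m} (next a) (suc p) p≢i p≢j
  with i′ , j′ , a′ , eq , eq′ ← neighbours-punchIn a p (p≢i ∘ ≡.cong suc) (p≢j ∘ ≡.cong suc)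
  = suc i′ , suc j′ , next a′ , ≡.cong suc eq , ≡.cong suc eq′

module Determinant {c ℓ} (R : CommutativeRing c ℓ) where

  open CommutativeRing R hiding (zero)
  open RingDefs R
  open Sum semiring hiding (sum)
  open RingProperties ring using (-1*x≈-x)
  open Solver commutativeSemiring
  open import Relation.Binary.Reasoning.Setoid setoid

  x-1*x≈0 : ∀ x → x + - 1# * x ≈ 0#
  x-1*x≈0 x = trans (+-congˡ (-1*x≈-x x)) (-‿inverseʳ x)

  Column : ℕ → Set c
  Column n = Vector Carrier n

  -- The number m of arguments is independent of the length n of the columns, so that fixing the
  -- first column of such an F gives another one and induction on the rows is possible.
  record Alternating {n m : ℕ} (F : Vec (Column n) m → Carrier) : Set (c ⊔ ℓ) where
    field
      linear : ∀ {X Y Z} j s t →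
        (∀ i → lookup X j i ≈ s * lookup Y j i + t * lookup Z j i) →
        (∀ k → k ≢ j → lookup X k ≡ lookup Y k × lookup X k ≡ lookup Z k) →
        F X ≈ s * F Y + t * F Z
      vanishing : ∀ {X} i j → Neighbours i j → lookup X i ≡ lookup X j → F X ≈ 0#

  open Alternating

  det-cong : ∀ {m} {M N : Vector (Vector Carrier m) m} → (∀ i j → M i j ≈ N i j) →
             det M ≈ det N
  det-cong {zero}  h = refl
  det-cong {suc m} h = sum-cong-≋ λ j →
    *-cong (*-congˡ {x = (- 1#) ^ toℕ j} (h zero j)) (det-cong λ i k → h (suc i) (punchIn j k))

  sum-linear : ∀ {m} s t (f g : Vector Carrier m) →
               sum (λ i → s * f i + t * g i) ≈ s * sum f + t * sum g
  sum-linear s t f g = trans (∑-distrib-+ (λ i → s * f i) (λ i → t * g i))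
    (+-cong (sym (*-distribˡ-sum s f)) (sym (*-distribˡ-sum t g)))

  det-linear : ∀ {m} {M Y Z : Vector (Vector Carrier m) m} j s t →
    (∀ i → M i j ≈ s * Y i j + t * Z i j) →
    (∀ i {k} → k ≢ j → M i k ≈ Y i k) → (∀ i {k} → k ≢ j → M i k ≈ Z i k) →
    det M ≈ s * det Y + t * det Z
  det-linear {suc m} {M} {Y} {Z} j s t M≈ M≈Y M≈Z =
    trans (sum-cong-≋ term) (sum-linear s t (T Y) (T Z))
    where
    minor : Vector (Vector Carrier (suc m)) (suc m) → Fin (suc m) → Vector (Vector Carrier m) m
    minor N p i = removeAt (N (suc i)) p
    T : Vector (Vector Carrier (suc m)) (suc m) → Vector Carrier (suc m)
    T N p = (- 1#) ^ toℕ p * N zero p * det (minor N p)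
    term : ∀ p → T M p ≈ s * T Y p + t * T Z p
    term p with p Fin.≟ j
    ... | yes ≡.refl = begin
      σ * M zero p * det (minor M p)                   ≈⟨ *-congʳ (*-congˡ (M≈ zero)) ⟩
      σ * (s * Y zero p + t * Z zero p) * det (minor M p)
        ≈⟨ solve 6 (λ σ s y t z d → σ :* (s :* y :+ t :* z) :* d :=
                    s :* (σ :* y :* d) :+ t :* (σ :* z :* d)) refl _ _ _ _ _ _ ⟩
      s * (σ * Y zero p * det (minor M p)) + t * (σ * Z zero p * det (minor M p))
        ≈⟨ +-cong (*-congˡ (*-congˡ (det-cong λ i k → M≈Y (suc i) (Fin.punchInᵢ≢i p k))))
                  (*-congˡ (*-congˡ (det-cong λ i k → M≈Z (suc i) (Fin.punchInᵢ≢i p k)))) ⟩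
      s * (σ * Y zero p * det (minor Y p)) + t * (σ * Z zero p * det (minor Z p)) ∎
      where σ = (- 1#) ^ toℕ p
    ... | no p≢j = begin
      σ * M zero p * det (minor M p)
        ≈⟨ *-congˡ (det-linear (punchOut p≢j) s t
             (λ i → at-j (λ q → M (suc i) q ≈ s * Y (suc i) q + t * Z (suc i) q) (M≈ (suc i)))
             (λ i k≢ → M≈Y (suc i) (avoid k≢)) (λ i k≢ → M≈Z (suc i) (avoid k≢))) ⟩
      σ * M zero p * (s * det (minor Y p) + t * det (minor Z p))
        ≈⟨ solve 6 (λ σ s y t z d → σ :* d :* (s :* y :+ t :* z) :=
                    s :* (σ :* d :* y) :+ t :* (σ :* d :* z)) refl _ _ _ _ _ _ ⟩
      s * (σ * M zero p * det (minor Y p)) + t * (σ * M zero p * det (minor Z p))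
        ≈⟨ +-cong (*-congˡ (*-congʳ (*-congˡ (M≈Y zero p≢j))))
                  (*-congˡ (*-congʳ (*-congˡ (M≈Z zero p≢j)))) ⟩
      s * (σ * Y zero p * det (minor Y p)) + t * (σ * Z zero p * det (minor Z p)) ∎
      where
      σ = (- 1#) ^ toℕ p
      at-j : ∀ {a} (P : Fin (suc m) → Set a) → P j → P (punchIn p (punchOut p≢j))
      at-j P = ≡.subst P (≡.sym (Fin.punchIn-punchOut p≢j))
      avoid : ∀ {k} → k ≢ punchOut p≢j → punchIn p k ≢ j
      avoid {k} k≢ eq = k≢ (Fin.punchIn-injective p k _
        (≡.trans eq (≡.sym (Fin.punchIn-punchOut p≢j))))

  sum-zero : ∀ {m} {f : Vector Carrier m} → (∀ i → f i ≈ 0#) → sum f ≈ 0#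
  sum-zero {m} h = trans (sum-cong-≋ h) (sum-replicate-zero m)

  sum-cancel : ∀ {m} {f : Vector Carrier m} {i j} → Neighbours i j → f i + f j ≈ 0# →
    (∀ p → p ≢ i → p ≢ j → f p ≈ 0#) → sum f ≈ 0#
  sum-cancel {f = f} first f+f≈0 h = trans (sym (+-assoc _ _ _))
    (trans (+-cong f+f≈0 (sum-zero λ p → h (suc (suc p)) (λ ()) (λ ()))) (+-identityʳ 0#))
  sum-cancel {f = f} (next a) f+f≈0 h = trans
    (+-cong (h zero (λ ()) (λ ()))
      (sum-cancel a f+f≈0 λ p p≢i p≢j →
        h (suc p) (p≢i ∘ Fin.suc-injective) (p≢j ∘ Fin.suc-injective)))
    (+-identityʳ 0#)

  -- In the expansion along the first row the minors without i and without j agree and have opposite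
  -- signs; every other minor still contains both columns as neighbours.
  det-vanishing : ∀ {m} {M : Vector (Vector Carrier m) m} {i j} → Neighbours i j →
    (∀ r → M r i ≈ M r j) → det M ≈ 0#
  det-vanishing {suc m} {M} {i} {j} a Mi≈Mj = sum-cancel a cancel other
    where
    minor≈ : ∀ r k → M (suc r) (punchIn j k) ≈ M (suc r) (punchIn i k)
    minor≈ r k with punchIn-neighbours a k
    ... | inj₁ eq = reflexive (≡.cong (M (suc r)) (≡.sym eq))
    ... | inj₂ (eq , eq′) rewrite eq | eq′ = Mi≈Mj (suc r)
    cancel : (- 1#) ^ toℕ i * M zero i * det (λ r → removeAt (M (suc r)) i) +
             (- 1#) ^ toℕ j * M zero j * det (λ r → removeAt (M (suc r)) j) ≈ 0#
    cancel rewrite toℕ-neighbours a = begin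
      σ * M zero i * d + - 1# * σ * M zero j * det (λ r → removeAt (M (suc r)) j)
        ≈⟨ +-congˡ (*-cong (*-congˡ (sym (Mi≈Mj zero))) (det-cong minor≈)) ⟩
      σ * M zero i * d + - 1# * σ * M zero i * d
        ≈⟨ +-congˡ (trans (*-congʳ (*-assoc _ _ _)) (*-assoc _ _ _)) ⟩
      σ * M zero i * d + - 1# * (σ * M zero i * d)
        ≈⟨ x-1*x≈0 _ ⟩
      0# ∎
      where
      σ = (- 1#) ^ toℕ i
      d = det (λ r → removeAt (M (suc r)) i)
    other : ∀ p → p ≢ i → p ≢ j → _ ≈ 0#
    other p p≢i p≢j with i′ , j′ , a′ , eq , eq′ ← neighbours-punchIn a p p≢i p≢j =
      trans (*-congˡ (det-vanishing a′ λ r →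
        trans (reflexive (≡.cong (M (suc r)) eq))
          (trans (Mi≈Mj (suc r)) (reflexive (≡.cong (M (suc r)) (≡.sym eq′))))))
        (zeroʳ _)

  det-alternating : ∀ {n} → Alternating {n} {n} (λ X → det λ i j → lookup X j i)
  det-alternating .linear j s t X≈ X≡ = det-linear j s t X≈
    (λ i k≢j → reflexive (≡.cong (λ c → c i) (proj₁ (X≡ _ k≢j))))
    (λ i k≢j → reflexive (≡.cong (λ c → c i) (proj₂ (X≡ _ k≢j))))
  det-alternating .vanishing i j a eq = det-vanishing a λ r → reflexive (≡.cong (λ c → c r) eq)

  scale : ∀ {m} → Fin m → Vector Carrier m → Vector (Vector Carrier m) m → Vector (Vector Carrier m) m
  scale j z M i k = (if does (k Fin.≟ j) then z i else 1#) * M i k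

  -- The diagonal matrix z acts as a derivation on the top exterior power, that is, by its trace. In
  -- the expansion along the first row, `z zero` goes to the column p chosen in that row, while the
  -- other summands act on the minor and reach the columns other than p.
  det-scale : ∀ {m} (z : Vector Carrier m) (M : Vector (Vector Carrier m) m) →
    sum z * det M ≈ sum λ j → det (scale j z M)
  det-scale {zero}  z M = zeroˡ _
  det-scale {suc m} z M = begin
    sum z * sum T                                   ≈⟨ *-distribˡ-sum (sum z) T ⟩
    sum (λ p → sum z * T p)                         ≈⟨ sum-cong-≋ expand ⟩
    sum (λ p → sum λ j → T′ j p)                    ≈⟨ ∑-comm (λ p j → T′ j p) ⟩
    sum (λ j → det (scale j z M))                   ∎
    where
    minor : Fin (suc m) → Vector (Vector Carrier m) m
    minor p i = removeAt (M (suc i)) p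
    T : Vector Carrier (suc m)
    T p = (- 1#) ^ toℕ p * M zero p * det (minor p)
    T′ : Fin (suc m) → Vector Carrier (suc m)
    T′ j p = (- 1#) ^ toℕ p * scale j z M zero p * det (λ i → removeAt (scale j z M (suc i)) p)
    factor : Fin (suc m) → Fin (suc m) → Fin (suc m) → Carrier
    factor k j i = if does (k Fin.≟ j) then z i else 1#
    factor-≡ : ∀ k i → factor k k i ≡ z i
    factor-≡ k i with k Fin.≟ k
    ... | yes _   = ≡.refl
    ... | no k≢k = contradiction ≡.refl k≢k
    factor-≢ : ∀ {k j} i → k ≢ j → factor k j i ≡ 1#
    factor-≢ {k} {j} i k≢j with k Fin.≟ j
    ... | yes k≡j = contradiction k≡j k≢j
    ... | no _    = ≡.refl
    factor-punchIn : ∀ p k j i → factor (punchIn p k) (punchIn p j) (suc i) ≡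
                     (if does (k Fin.≟ j) then z (suc i) else 1#)
    factor-punchIn p k j i with k Fin.≟ j
    ... | yes ≡.refl = factor-≡ (punchIn p k) (suc i)
    ... | no k≢j     = factor-≢ (suc i) (k≢j ∘ Fin.punchIn-injective p k j)
    expand : ∀ p → sum z * T p ≈ sum λ j → T′ j p
    expand p = begin
      (z zero + sum z₊) * (σ * M zero p * det (minor p))
        ≈⟨ solve 5 (λ z s σ x d → (z :+ s) :* (σ :* x :* d) :=
                    σ :* (z :* x) :* d :+ σ :* x :* (s :* d)) refl _ _ _ _ _ ⟩
      σ * (z zero * M zero p) * det (minor p) + σ * M zero p * (sum z₊ * det (minor p))
        ≈⟨ +-cong (*-cong (*-congˡ (*-congʳ (reflexive (≡.sym (factor-≡ p zero)))))
                          (det-cong λ i k → sym (trans (*-congʳ (reflexive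
                             (factor-≢ (suc i) (Fin.punchInᵢ≢i p k)))) (*-identityˡ _))))
                  (*-congˡ (det-scale z₊ (minor p))) ⟩
      T′ p p + σ * M zero p * sum (λ j → det (scale j z₊ (minor p)))
        ≈⟨ +-congˡ (*-distribˡ-sum _ λ j → det (scale j z₊ (minor p))) ⟩
      T′ p p + sum (λ j → σ * M zero p * det (scale j z₊ (minor p)))
        ≈⟨ +-congˡ (sum-cong-≋ λ j → *-cong
             (*-congˡ (sym (trans (*-congʳ (reflexive
               (factor-≢ zero (Fin.punchInᵢ≢i p j ∘ ≡.sym)))) (*-identityˡ _))))
             (det-cong λ i k → *-congʳ (reflexive (≡.sym (factor-punchIn p k j i))))) ⟩
      T′ p p + sum (λ j → T′ (punchIn p j) p)
        ≈⟨ sum-remove (λ j → T′ j p) ⟨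
      sum (λ j → T′ j p) ∎
      where
      σ = (- 1#) ^ toℕ p
      z₊ = λ i → z (suc i)

-- Straightening

module Straightening {c ℓ} (R : CommutativeRing c ℓ) where

  open CommutativeRing R hiding (zero)
  open RingDefs R
  open Exp semiring hiding (_^_)
  open Mult semiring hiding (_×_)
  open Determinant R
  open Alternating
  open Sum semiring hiding (sum)
  open Solver commutativeSemiring
  open import Relation.Binary.Reasoning.Setoid setoid

  -- Sums over lists

  ∑ : ∀ {a} {A : Set a} → (A → Carrier) → List A → Carrier
  ∑ f = foldr (λ a t → f a + t) 0#

  module _ {a} {A : Set a} where

    ∑-++ : ∀ (f : A → Carrier) xs {ys} → ∑ f (xs ++ ys) ≈ ∑ f xs + ∑ f ys
    ∑-++ f []       = sym (+-identityˡ _)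
    ∑-++ f (x ∷ xs) = trans (+-congˡ (∑-++ f xs)) (sym (+-assoc _ _ _))

    ∑-cong : ∀ {f g : A → Carrier} → (∀ x → f x ≈ g x) → ∀ xs → ∑ f xs ≈ ∑ g xs
    ∑-cong h []       = refl
    ∑-cong h (x ∷ xs) = +-cong (h x) (∑-cong h xs)

    ∑-zero : ∀ (xs : List A) → ∑ (λ _ → 0#) xs ≈ 0#
    ∑-zero []       = refl
    ∑-zero (_ ∷ xs) = trans (+-identityˡ _) (∑-zero xs)

    ∑-+ : ∀ (f g : A → Carrier) xs → ∑ (λ x → f x + g x) xs ≈ ∑ f xs + ∑ g xs
    ∑-+ f g []       = sym (+-identityˡ 0#)
    ∑-+ f g (x ∷ xs) = trans (+-congˡ (∑-+ f g xs))
      (solve 4 (λ a b c d → (a :+ b) :+ (c :+ d) := (a :+ c) :+ (b :+ d)) refl _ _ _ _)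

    ∑-*ˡ : ∀ s (f : A → Carrier) xs → ∑ (λ x → s * f x) xs ≈ s * ∑ f xs
    ∑-*ˡ s f []       = sym (zeroʳ s)
    ∑-*ˡ s f (x ∷ xs) = trans (+-congˡ (∑-*ˡ s f xs)) (sym (distribˡ _ _ _))

  ∑-map : ∀ {a b} {A : Set a} {B : Set b} (f : B → Carrier) (g : A → B) xs →
          ∑ f (map g xs) ≈ ∑ (f ∘ g) xs
  ∑-map f g []       = refl
  ∑-map f g (x ∷ xs) = +-congˡ (∑-map f g xs)

  ∑-prepend : ∀ {m} (f : Vec ℕ (suc m) → Carrier) vs (g : ℕ → List (Vec ℕ m)) →
    ∑ f (prepend vs g) ≈ ∑ (λ v → ∑ (λ ν → f (v ∷ ν)) (g v)) vs
  ∑-prepend f []       g = refl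
  ∑-prepend f (v ∷ vs) g = trans (∑-++ f (map (v ∷_) (g v)))
    (+-cong (∑-map f (v ∷_) (g v)) (∑-prepend f vs g))

  ∑-interval-cong : ∀ {f g} p d → (∀ v → p < v → f v ≈ g v) →
    ∑ f (interval p d) ≈ ∑ g (interval p d)
  ∑-interval-cong p zero    h = refl
  ∑-interval-cong p (suc d) h = +-cong (h (suc p) ℕ.≤-refl)
    (∑-interval-cong (suc p) d λ v p<v → h v (ℕ.<-trans (ℕ.n<1+n p) p<v))

  -- Only the index of g is shifted. The boundary terms stand on opposite sides, so that no
  -- subtraction enters; both vanish where this is applied.
  ∑-telescope : ∀ (g h : ℕ → Carrier) p d →
    g p + ∑ (λ q → g q + h q) (interval p d) ≈
    ∑ (λ q → g (pred q) + h q) (interval p d) + g (p ℕ.+ d)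
  ∑-telescope g h p zero rewrite ℕ.+-identityʳ p = +-comm _ _
  ∑-telescope g h p (suc d) rewrite ℕ.+-suc p d = begin
    g p + ((g (suc p) + h (suc p)) + s)
      ≈⟨ solve 4 (λ a b c s → a :+ ((b :+ c) :+ s) := (a :+ c) :+ (b :+ s)) refl _ _ _ _ ⟩
    (g p + h (suc p)) + (g (suc p) + s)
      ≈⟨ +-congˡ (∑-telescope g h (suc p) d) ⟩
    (g p + h (suc p)) + (s′ + g (suc (p ℕ.+ d)))
      ≈⟨ +-assoc _ _ _ ⟨
    (g p + h (suc p)) + s′ + g (suc (p ℕ.+ d)) ∎
    where
    s  = ∑ (λ q → g q + h q) (interval (suc p) d)
    s′ = ∑ (λ q → g (pred q) + h q) (interval (suc p) d)

  ∑-cong-∈ : ∀ {a} {A : Set a} {f g : A → Carrier} xs → (∀ {x} → x ∈ xs → f x ≈ g x) → ∑ f xs ≈ ∑ g xs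
  ∑-cong-∈ []       h = refl
  ∑-cong-∈ (x ∷ xs) h = +-cong (h (here ≡.refl)) (∑-cong-∈ xs (h ∘ there))

  -- In `col m j e` the numbers m and j count the rows below and above, and e is the entry. The
  -- straightening knows the columns through `col-suc` only.
  module Columns {n : ℕ} (δ : Carrier) (col : ℕ → ℕ → ℕ → Vector Carrier n)
    (col-suc : ∀ m j e i → col (suc m) j e i ≈ col m (suc j) (suc e) i + δ * col (suc m) j (suc e) i)
    where

    -- Exchange relations for alternating functions

    module _ {m} {F : Vec (Column n) (suc m) → Carrier} (alt : Alternating F) where

      linear-head : ∀ {c d e X} s t → (∀ i → c i ≈ s * d i + t * e i) →
        F (c ∷ X) ≈ s * F (d ∷ X) + t * F (e ∷ X)
      linear-head s t h = alt .linear zero s t h λ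
        { zero    0≢0 → contradiction ≡.refl 0≢0
        ; (suc k) _   → ≡.refl , ≡.refl }

      alternating-∷ : ∀ c → Alternating (λ X → F (c ∷ X))
      alternating-∷ c .linear j s t h h′ = alt .linear (suc j) s t h λ
        { zero    _   → ≡.refl , ≡.refl
        ; (suc k) k≢j → h′ k (k≢j ∘ ≡.cong suc) }
      alternating-∷ c .vanishing i j a eq = alt .vanishing (suc i) (suc j) (next a) eq

    module _ {m} {F : Vec (Column n) (suc (suc m)) → Carrier} (alt : Alternating F) where

      swap : ∀ c d X → F (c ∷ d ∷ X) ≈ - 1# * F (d ∷ c ∷ X)
      swap c d X = begin
        F (c ∷ d ∷ X)                                       ≈⟨ +-identityʳ _ ⟨
        F (c ∷ d ∷ X) + 0#                                  ≈⟨ +-congˡ (x-1*x≈0 _) ⟨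
        F (c ∷ d ∷ X) + (F (d ∷ c ∷ X) + - 1# * F (d ∷ c ∷ X)) ≈⟨ +-assoc _ _ _ ⟨
        F (c ∷ d ∷ X) + F (d ∷ c ∷ X) + - 1# * F (d ∷ c ∷ X)   ≈⟨ +-congʳ sum≈0 ⟩
        0# + - 1# * F (d ∷ c ∷ X)                           ≈⟨ +-identityˡ _ ⟩
        - 1# * F (d ∷ c ∷ X)                                ∎
        where
        e : Column n
        e i = c i + d i
        e≈ : ∀ i → e i ≈ 1# * c i + 1# * d i
        e≈ i = sym (+-cong (*-identityˡ _) (*-identityˡ _))
        square : ∀ x → F (x ∷ x ∷ X) ≈ 0#
        square x = alt .vanishing zero (suc zero) first ≡.refl
        split : ∀ x → F (x ∷ e ∷ X) ≈ 1# * F (x ∷ c ∷ X) + 1# * F (x ∷ d ∷ X)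
        split x = linear-head (alternating-∷ alt x) 1# 1# e≈
        sum≈0 : F (c ∷ d ∷ X) + F (d ∷ c ∷ X) ≈ 0#
        sum≈0 = sym (begin
          0#                                    ≈⟨ square e ⟨
          F (e ∷ e ∷ X)                         ≈⟨ linear-head alt 1# 1# e≈ ⟩
          1# * F (c ∷ e ∷ X) + 1# * F (d ∷ e ∷ X)
            ≈⟨ +-cong (*-congˡ (split c)) (*-congˡ (split d)) ⟩
          1# * (1# * F (c ∷ c ∷ X) + 1# * F (c ∷ d ∷ X)) +
          1# * (1# * F (d ∷ c ∷ X) + 1# * F (d ∷ d ∷ X))
            ≈⟨ +-cong (*-congˡ (+-congʳ (*-congˡ (square c)))) (*-congˡ (+-congˡ (*-congˡ (square d)))) ⟩
          1# * (1# * 0# + 1# * F (c ∷ d ∷ X)) + 1# * (1# * F (d ∷ c ∷ X) + 1# * 0#)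
            ≈⟨ solve 2 (λ x y → con 1 :* (con 1 :* con 0 :+ con 1 :* x) :+
                                con 1 :* (con 1 :* y :+ con 1 :* con 0) := x :+ y) refl _ _ ⟩
          F (c ∷ d ∷ X) + F (d ∷ c ∷ X)         ∎)

      expand-second : ∀ j e b X → F (b ∷ col (suc m) j e ∷ X) ≈
        F (b ∷ col m (suc j) (suc e) ∷ X) + δ * F (b ∷ col (suc m) j (suc e) ∷ X)
      expand-second j e b X = trans
        (linear-head (alternating-∷ alt b) 1# δ λ i →
          trans (col-suc m j e i) (+-congʳ (sym (*-identityˡ _))))
        (+-congʳ (*-identityˡ _))

      -- Each use of the relation either brings the second column into its own row or leaves it
      -- there with its entry raised by one and a factor δ. After d uses the column left over equals
      -- the first one and vanishes.
      expand-chain : ∀ j l d X → F (col (suc m) j (l ℕ.+ d) ∷ col (suc m) j l ∷ X) ≈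
        ∑ (λ v → δ ^ (v ∸ suc l) * F (col (suc m) j (l ℕ.+ d) ∷ col m (suc j) v ∷ X)) (interval l d)
      expand-chain j l zero    X rewrite ℕ.+-identityʳ l = alt .vanishing zero (suc zero) first ≡.refl
      expand-chain j l (suc d) X rewrite ℕ.+-suc l d = begin
        F (b ∷ col (suc m) j l ∷ X)
          ≈⟨ expand-second j l b X ⟩
        t (suc l) + δ * F (b ∷ col (suc m) j (suc l) ∷ X)
          ≈⟨ +-cong (sym (trans (*-congʳ (reflexive (≡.cong (δ ^_) (ℕ.n∸n≡0 (suc l))))) (*-identityˡ _)))
                    (*-congˡ (expand-chain j (suc l) d X)) ⟩
        δ ^ (suc l ∸ suc l) * t (suc l) + δ * ∑ (λ v → δ ^ (v ∸ suc (suc l)) * t v) (interval (suc l) d)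
          ≈⟨ +-congˡ (∑-*ˡ δ _ (interval (suc l) d)) ⟨
        δ ^ (suc l ∸ suc l) * t (suc l) + ∑ (λ v → δ * (δ ^ (v ∸ suc (suc l)) * t v)) (interval (suc l) d)
          ≈⟨ +-congˡ (∑-interval-cong (suc l) d λ v l<v → trans (sym (*-assoc _ _ _))
               (*-congʳ (reflexive (≡.cong (δ ^_) (≡.sym (ℕ.+-∸-assoc 1 l<v)))))) ⟩
        δ ^ (suc l ∸ suc l) * t (suc l) + ∑ (λ v → δ ^ (v ∸ suc l) * t v) (interval (suc l) d) ∎
        where
        b = col (suc m) j (suc (l ℕ.+ d))
        t : ℕ → Carrier
        t v = F (b ∷ col m (suc j) v ∷ X)

      -- The relation is solved for the column of the lower row, and in both resulting terms the two
      -- columns, now of the same row, are swapped.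
      exchange : ∀ j l e X → F (col (suc m) j l ∷ col m (suc j) (suc e) ∷ X) ≈
        - 1# * F (col (suc m) j e ∷ col (suc m) j l ∷ X) + δ * F (col (suc m) j (suc e) ∷ col (suc m) j l ∷ X)
      exchange j l e X = begin
        x                              ≈⟨ +-identityʳ x ⟨
        x + 0#                         ≈⟨ +-congˡ (trans (*-congˡ (x-1*x≈0 w′)) (zeroʳ δ)) ⟨
        x + δ * (w′ + - 1# * w′)       ≈⟨ +-congˡ (*-congˡ (+-congˡ (swap _ _ X))) ⟨
        x + δ * (w′ + w)
          ≈⟨ solve 4 (λ x δ w′ w → x :+ δ :* (w′ :+ w) := x :+ δ :* w :+ δ :* w′) refl _ _ _ _ ⟩
        x + δ * w + δ * w′             ≈⟨ +-congʳ (expand-second j e _ X) ⟨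
        F (col (suc m) j l ∷ col (suc m) j e ∷ X) + δ * w′
          ≈⟨ +-congʳ (swap _ _ X) ⟩
        - 1# * F (col (suc m) j e ∷ col (suc m) j l ∷ X) + δ * w′ ∎
        where
        x  = F (col (suc m) j l ∷ col m (suc j) (suc e) ∷ X)
        w  = F (col (suc m) j l ∷ col (suc m) j (suc e) ∷ X)
        w′ = F (col (suc m) j (suc e) ∷ col (suc m) j l ∷ X)

    -- Expansion into chains

    cols : ∀ {m} → ℕ → Vec ℕ m → Vec (Column n) m
    cols         j []      = []
    cols {suc m} j (l ∷ ƛ) = col m j l ∷ cols (suc j) ƛ

    -- The sum over d of a d (λ d) Φ (cols j λ without its d-th column), where λ = l ∷ ƛ.
    omit omit⁺ : ∀ {m} → (ℕ → ℕ → Carrier) → ℕ → (Vec (Column n) m → Carrier) → ℕ → Vec ℕ m → Carrier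
    omit a j Φ l ƛ = a 0 l * Φ (cols (suc j) ƛ) + omit⁺ a j Φ l ƛ
    omit⁺         a j Φ l []       = 0#
    omit⁺ {suc m} a j Φ l (l′ ∷ ƛ) = omit (a ∘ suc) (suc j) (λ X → Φ (col (suc m) j l ∷ X)) l′ ƛ

    omit-cong : ∀ {m a a′ j} {Φ Ψ : Vec (Column n) m → Carrier} {l ƛ} → IsPartition (l ∷ ƛ) →
      (∀ d {b} → b ≤ l → a d b ≈ a′ d b) → (∀ X → Φ X ≈ Ψ X) → omit a j Φ l ƛ ≈ omit a′ j Ψ l ƛ
    omit-cong {ƛ = []} p h h′ = +-congʳ (*-cong (h 0 ℕ.≤-refl) (h′ _))
    omit-cong {ƛ = l′ ∷ ƛ} (l′≤l ∷ p) h h′ = +-cong (*-cong (h 0 ℕ.≤-refl) (h′ _))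
      (omit-cong p (λ d b≤l′ → h (suc d) (ℕ.≤-trans b≤l′ l′≤l)) (λ X → h′ _))

    omit-linear : ∀ {m} a j (Φ Ψ : Vec (Column n) m → Carrier) s t l ƛ →
      omit a j (λ X → s * Φ X + t * Ψ X) l ƛ ≈ s * omit a j Φ l ƛ + t * omit a j Ψ l ƛ
    omit-linear a j Φ Ψ s t l [] =
      solve 5 (λ a s t x y → a :* (s :* x :+ t :* y) :+ con 0 :=
        s :* (a :* x :+ con 0) :+ t :* (a :* y :+ con 0)) refl _ _ _ _ _
    omit-linear a j Φ Ψ s t l (l′ ∷ ƛ) = trans (+-congˡ (omit-linear _ _ _ _ s t l′ ƛ))
      (solve 7 (λ a s t x y u v → a :* (s :* x :+ t :* y) :+ (s :* u :+ t :* v) :=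
        s :* (a :* x :+ u) :+ t :* (a :* y :+ v)) refl _ _ _ _ _ _ _)

    omit-linear-coeff : ∀ {m} a a′ j (Φ : Vec (Column n) m → Carrier) s t l ƛ →
      omit (λ d b → s * a d b + t * a′ d b) j Φ l ƛ ≈ s * omit a j Φ l ƛ + t * omit a′ j Φ l ƛ
    omit-linear-coeff a a′ j Φ s t l [] =
      solve 5 (λ a b s t x → (s :* a :+ t :* b) :* x :+ con 0 :=
        s :* (a :* x :+ con 0) :+ t :* (b :* x :+ con 0)) refl _ _ _ _ _
    omit-linear-coeff a a′ j Φ s t l (l′ ∷ ƛ) = trans (+-congˡ (omit-linear-coeff _ _ _ _ s t l′ ƛ))
      (solve 7 (λ a b s t x u v → (s :* a :+ t :* b) :* x :+ (s :* u :+ t :* v) :=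
        s :* (a :* x :+ u) :+ t :* (b :* x :+ v)) refl _ _ _ _ _ _ _)

    omit-zero : ∀ {m} a j {Φ : Vec (Column n) m → Carrier} l ƛ → (∀ X → Φ X ≈ 0#) →
      omit a j Φ l ƛ ≈ 0#
    omit-zero a j l []       h = trans (+-identityʳ _) (trans (*-congˡ (h _)) (zeroʳ _))
    omit-zero a j l (l′ ∷ ƛ) h = trans (+-cong (trans (*-congˡ (h _)) (zeroʳ _))
      (omit-zero _ _ l′ ƛ λ X → h _)) (+-identityʳ 0#)

    omit-zero-coeff : ∀ {m a} j {Φ : Vec (Column n) m → Carrier} {l ƛ} → IsPartition (l ∷ ƛ) →
      (∀ d {b} → b ≤ l → a d b ≈ 0#) → omit a j Φ l ƛ ≈ 0#
    omit-zero-coeff j {ƛ = []} p h =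
      trans (+-identityʳ _) (trans (*-congʳ (h 0 ℕ.≤-refl)) (zeroˡ _))
    omit-zero-coeff j {ƛ = l′ ∷ ƛ} (l′≤l ∷ p) h = trans
      (+-cong (trans (*-congʳ (h 0 ℕ.≤-refl)) (zeroˡ _))
        (omit-zero-coeff (suc j) p λ d b≤l′ → h (suc d) (ℕ.≤-trans b≤l′ l′≤l)))
      (+-identityʳ 0#)

    omit-∑ : ∀ {m a j} {s : ℕ → Carrier} {Φ : ℕ → Vec (Column n) m → Carrier} {l ƛ} →
      IsPartition (l ∷ ƛ) → ∀ vs →
      omit a j (λ X → ∑ (λ v → s v * Φ v X) vs) l ƛ ≈ ∑ (λ v → s v * omit a j (Φ v) l ƛ) vs
    omit-∑ {a = a} {j} {l = l} {ƛ} p [] = omit-zero a j l ƛ λ _ → refl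
    omit-∑ {a = a} {j} {s} {Φ} {l} {ƛ} p (v ∷ vs) = begin
      omit a j (λ X → s v * Φ v X + rest X) l ƛ
        ≈⟨ omit-cong p (λ d _ → refl) (λ X → +-congˡ (sym (*-identityˡ _))) ⟩
      omit a j (λ X → s v * Φ v X + 1# * rest X) l ƛ
        ≈⟨ omit-linear a j (Φ v) rest (s v) 1# l ƛ ⟩
      s v * omit a j (Φ v) l ƛ + 1# * omit a j rest l ƛ
        ≈⟨ +-congˡ (trans (*-identityˡ _) (omit-∑ p vs)) ⟩
      s v * omit a j (Φ v) l ƛ + ∑ (λ v → s v * omit a j (Φ v) l ƛ) vs ∎
      where
      rest : Vec (Column n) _ → Carrier
      rest X = ∑ (λ v → s v * Φ v X) vs

    -- The case v ≤ l occurs only at the end of a chain, where v ∷ ν = l′ ∷ ƛ.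
    chainWeight : ∀ {m} → (ℕ → ℕ → Carrier) → ℕ → Vec ℕ m → Vec ℕ m → Carrier
    chainWeight a l []       []      = a 0 l
    chainWeight a l (l′ ∷ ƛ) (v ∷ ν) =
      if does (v ℕ.≤? l) then a 0 l else δ ^ (v ∸ suc l) * chainWeight (a ∘ suc) l′ ƛ ν

    chainWeight-stop : ∀ {m} a {l} {ƛ : Vec ℕ m} → IsPartition (l ∷ ƛ) → chainWeight a l ƛ ƛ ≡ a 0 l
    chainWeight-stop a {ƛ = []} p = ≡.refl
    chainWeight-stop a {l} {ƛ = l′ ∷ ƛ} (l′≤l ∷ p) rewrite dec-true (l′ ℕ.≤? l) l′≤l = ≡.refl

    chainWeight-step : ∀ {m} a {l l′ v} (ƛ ν : Vec ℕ m) → l < v →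
      chainWeight a l (l′ ∷ ƛ) (v ∷ ν) ≡ δ ^ (v ∸ suc l) * chainWeight (a ∘ suc) l′ ƛ ν
    chainWeight-step a {l} {v = v} ƛ ν l<v rewrite dec-false (v ℕ.≤? l) (ℕ.<⇒≱ l<v) = ≡.refl

    -- Below the column with entry v, the omission at d = 0 leaves all columns in their own rows, so
    -- the chain stops. In the other terms the next column, with entry l, stands one row too low;
    -- `expand-chain` gives it the entries v′ with l < v′ ≤ v, and v′ takes the part of v. Chains
    -- outside `Q` have coefficient zero.
    chains-sum : ∀ {m} {F : Vec (Column n) (suc m) → Carrier} → Alternating F →
      ∀ {a} {Q : ℕ → ℕ → Set} (Q? : ∀ d b → Dec (Q d b)) → (∀ d b → ¬ Q d b → a d b ≈ 0#) →
      ∀ j {v l ƛ} → IsPartition (l ∷ ƛ) → l < v →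
      omit a j (λ X → F (col m j v ∷ X)) l ƛ ≈
      ∑ (λ ν → chainWeight a l ƛ ν * F (col m j v ∷ cols (suc j) ν)) (chains Q? v l ƛ)
    chains-sum {m} {F} alt {a} Q? a≈0 j {v} {l} {ƛ} p l<v = go ƛ p
      where
      only-sum : ∀ ƛ → IsPartition (l ∷ ƛ) →
        a 0 l * F (col m j v ∷ cols (suc j) ƛ) ≈
        ∑ (λ ν → chainWeight a l ƛ ν * F (col m j v ∷ cols (suc j) ν)) (only (Q? 0 l) ƛ)
      only-sum ƛ p with Q? 0 l
      ... | yes _ = trans (*-congʳ (reflexive (≡.sym (chainWeight-stop a p)))) (sym (+-identityʳ _))
      ... | no ¬q = trans (*-congʳ (a≈0 _ _ ¬q)) (zeroˡ _)
      go : ∀ ƛ → IsPartition (l ∷ ƛ) → omit a j (λ X → F (col m j v ∷ X)) l ƛ ≈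
        ∑ (λ ν → chainWeight a l ƛ ν * F (col m j v ∷ cols (suc j) ν)) (chains Q? v l ƛ)
      go []       p = trans (+-identityʳ _) (only-sum [] p)
      go (l′ ∷ ƛ) (l′≤l ∷ p) = trans
        (+-cong (only-sum (l′ ∷ ƛ) (l′≤l ∷ p)) (begin
          omit (a ∘ suc) (suc j) (λ X → F (col m j v ∷ col m j l ∷ X)) l′ ƛ
            ≈⟨ omit-cong p (λ d _ → refl) (λ X → expand X) ⟩
          omit (a ∘ suc) (suc j) (λ X → ∑ (λ v′ → δ ^ (v′ ∸ suc l) * Φ v′ X) vs) l′ ƛ
            ≈⟨ omit-∑ p vs ⟩
          ∑ (λ v′ → δ ^ (v′ ∸ suc l) * omit (a ∘ suc) (suc j) (Φ v′) l′ ƛ) vs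
            ≈⟨ ∑-interval-cong l (v ∸ l) (λ v′ l<v′ → begin
                 δ ^ (v′ ∸ suc l) * omit (a ∘ suc) (suc j) (Φ v′) l′ ƛ
                   ≈⟨ *-congˡ (chains-sum (alternating-∷ alt (col m j v)) (Q? ∘ suc) (a≈0 ∘ suc)
                        (suc j) p (ℕ.≤-<-trans l′≤l l<v′)) ⟩
                 δ ^ (v′ ∸ suc l) * ∑ (λ ν → chainWeight (a ∘ suc) l′ ƛ ν * Φ v′ (cols (suc (suc j)) ν)) (tails v′)
                   ≈⟨ ∑-*ˡ _ _ (tails v′) ⟨
                 ∑ (λ ν → δ ^ (v′ ∸ suc l) * (chainWeight (a ∘ suc) l′ ƛ ν * Φ v′ (cols (suc (suc j)) ν))) (tails v′)
                   ≈⟨ ∑-cong (λ ν → trans (sym (*-assoc _ _ _)) (*-congʳ (reflexive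
                        (≡.sym (chainWeight-step a ƛ ν l<v′))))) (tails v′) ⟩
                 ∑ (λ ν → chainWeight a l (l′ ∷ ƛ) (v′ ∷ ν) * F (col m j v ∷ cols (suc j) (v′ ∷ ν))) (tails v′) ∎) ⟩
          ∑ (λ v′ → ∑ (λ ν → chainWeight a l (l′ ∷ ƛ) (v′ ∷ ν) * F (col m j v ∷ cols (suc j) (v′ ∷ ν))) (tails v′)) vs
            ≈⟨ ∑-prepend _ vs tails ⟨
          ∑ (λ ν → chainWeight a l (l′ ∷ ƛ) ν * F (col m j v ∷ cols (suc j) ν)) (prepend vs tails) ∎))
        (sym (∑-++ _ (only (Q? 0 l) (l′ ∷ ƛ)) {prepend vs tails}))
        where
        vs = interval l (v ∸ l)
        tails : ℕ → List (Vec ℕ _)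
        tails v′ = chains (Q? ∘ suc) v′ l′ ƛ
        Φ : ℕ → Vec (Column n) _ → Carrier
        Φ v′ X = F (col m j v ∷ col (pred m) (suc j) v′ ∷ X)
        expand : ∀ X → F (col m j v ∷ col m j l ∷ X) ≈ ∑ (λ v′ → δ ^ (v′ ∸ suc l) * Φ v′ X) vs
        expand X = ≡.subst (λ v → F (col m j v ∷ col m j l ∷ X) ≈
            ∑ (λ v′ → δ ^ (v′ ∸ suc l) * F (col m j v ∷ col (pred m) (suc j) v′ ∷ X)) vs)
          (ℕ.m+[n∸m]≡n (ℕ.<⇒≤ l<v)) (expand-chain alt j l (v ∸ l) X)

    -- Moving the column with entry N up by d rows expands it in the columns of the new row;
    -- transfer d N q is the coefficient of the one with entry q, including the sign (- 1) ^ d.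
    transfer : ℕ → ℕ → ℕ → Carrier
    transfer zero    N q = if does (N ℕ.≟ q) then 1# else 0#
    transfer (suc d) N q = - 1# * transfer d N (suc q) + δ * transfer d N q

    transfer-above : ∀ d {N q} → N < q → transfer d N q ≈ 0#
    transfer-above zero {N} {q} N<q rewrite dec-false (N ℕ.≟ q) (ℕ.<⇒≢ N<q) = refl
    transfer-above (suc d) N<q = trans
      (+-cong (trans (*-congˡ (transfer-above d (ℕ.m<n⇒m<1+n N<q))) (zeroʳ _))
              (trans (*-congˡ (transfer-above d N<q)) (zeroʳ _)))
      (+-identityʳ 0#)

    transfer-below : ∀ d {N q} → q ℕ.+ d < N → transfer d N q ≈ 0#
    transfer-below zero {N} {q} q<N rewrite ℕ.+-identityʳ q | dec-false (N ℕ.≟ q) (ℕ.>⇒≢ q<N) = refl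
    transfer-below (suc d) {N} {q} q+d<N rewrite ℕ.+-suc q d = trans
      (+-cong (trans (*-congˡ (transfer-below d q+d<N)) (zeroʳ _))
              (trans (*-congˡ (transfer-below d (ℕ.<-trans (ℕ.n<1+n _) q+d<N))) (zeroʳ _)))
      (+-identityʳ 0#)

    -- The coefficient with which the column of entry b, enlarged by k and coming from d rows below,
    -- arrives in the current row with entry q.
    rowWeight : ℕ → ℕ → ℕ → ℕ → Carrier
    rowWeight k q d b = transfer d (b ℕ.+ k) q

    -- The sum runs along a list of bare vectors, so the coefficient has to be recovered from ν; the
    -- first row that exceeds λ is the one in which the enlarged column stopped.
    weight : ∀ {m} → ℕ → Vec ℕ m → Vec ℕ m → Carrier
    weight k []      []      = 0#
    weight k (l ∷ ƛ) (v ∷ ν) =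
      if does (v ℕ.≤? l) then weight k ƛ ν else chainWeight (rowWeight k v) l ƛ ν

    weight-here : ∀ {m} k {l v} (ƛ ν : Vec ℕ m) → l < v →
      weight k (l ∷ ƛ) (v ∷ ν) ≡ chainWeight (rowWeight k v) l ƛ ν
    weight-here k {l} {v} ƛ ν l<v rewrite dec-false (v ℕ.≤? l) (ℕ.<⇒≱ l<v) = ≡.refl

    weight-there : ∀ {m} k l (ƛ ν : Vec ℕ m) → weight k (l ∷ ƛ) (l ∷ ν) ≡ weight k ƛ ν
    weight-there k l ƛ ν rewrite dec-true (l ℕ.≤? l) ℕ.≤-refl = ≡.refl

    rowWeight-outside : ∀ k v d b → ¬ Window k v d b → rowWeight k v d b ≈ 0#
    rowWeight-outside k v d b ¬w with v ∸ b ℕ.≤? k | k ℕ.≤? (v ∸ b) ℕ.+ d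
    ... | yes p | yes q = contradiction (p , q) ¬w
    ... | no p  | _     = transfer-above d (ℕ.≰⇒> λ v≤ → p (ℕ.m≤n+o⇒m∸n≤o v b v≤))
    ... | yes _ | no q  = transfer-below d (ℕ.≤-<-trans
      (ℕ.≤-trans (ℕ.+-monoˡ-≤ d (ℕ.m≤n+m∸n v b)) (ℕ.≤-reflexive (ℕ.+-assoc b (v ∸ b) d)))
      (ℕ.+-monoʳ-< b (ℕ.≰⇒> q)))

    -- The columns which exceed U and therefore have to move up beyond the current row.
    pending : ∀ {m} → (Vec (Column n) m → Carrier) → ℕ → ℕ → ℕ → ℕ → Vec ℕ m → Carrier
    pending         F k j U M []      = 0#
    pending {suc m} F k j U M (l ∷ ƛ) =
      ∑ (λ q → omit (rowWeight k q) j (λ X → F (col m j q ∷ X)) l ƛ) (interval U (M ∸ U))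

    -- Exchanging a column of entry q with the column of entry l above it produces the entries q - 1
    -- and q. Collected by the new entry, the coefficients obey the recurrence that defines
    -- `transfer`.
    transfer-up : ∀ {m} {F : Vec (Column n) (suc (suc m)) → Carrier} → Alternating F →
      ∀ k j {l l′ M ƛ} → IsPartition (l′ ∷ ƛ) → l′ ≤ l → l ≤ M → l ℕ.+ k ≤ M →
      ∑ (λ q → omit (rowWeight k q) (suc j) (λ X → F (col (suc m) j l ∷ col m (suc j) q ∷ X)) l′ ƛ)
        (interval l (M ∸ l)) ≈
      ∑ (λ q → omit (rowWeight k q ∘ suc) (suc j) (λ X → F (col (suc m) j q ∷ col (suc m) j l ∷ X)) l′ ƛ)
        (interval l (M ∸ l))
    transfer-up {m} {F} alt k j {l} {l′} {M} {ƛ} p l′≤l l≤M l+k≤M = begin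
      ∑ (λ q → omit (rowWeight k q) (suc j) (λ X → F (col (suc m) j l ∷ col m (suc j) q ∷ X)) l′ ƛ) vs
        ≈⟨ ∑-interval-cong l (M ∸ l) (λ { (suc q) _ → trans
             (omit-cong p (λ d _ → refl) (exchange alt j l q))
             (omit-linear _ _ _ _ (- 1#) δ l′ ƛ) }) ⟩
      ∑ (λ q → g (pred q) + h q) vs
        ≈⟨ trans (+-congˡ gM≈0) (+-identityʳ _) ⟨
      ∑ (λ q → g (pred q) + h q) vs + g (l ℕ.+ (M ∸ l))
        ≈⟨ ∑-telescope g h l (M ∸ l) ⟨
      g l + ∑ (λ q → g q + h q) vs
        ≈⟨ trans (+-congʳ gl≈0) (+-identityˡ _) ⟩
      ∑ (λ q → g q + h q) vs
        ≈⟨ ∑-cong (λ q → sym (omit-linear-coeff _ _ _ _ (- 1#) δ l′ ƛ)) vs ⟩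
      ∑ (λ q → omit (rowWeight k q ∘ suc) (suc j) (λ X → F (col (suc m) j q ∷ col (suc m) j l ∷ X)) l′ ƛ) vs ∎
      where
      vs = interval l (M ∸ l)
      H : ℕ → ℕ → Carrier
      H q e = omit (rowWeight k q) (suc j) (λ X → F (col (suc m) j e ∷ col (suc m) j l ∷ X)) l′ ƛ
      g h : ℕ → Carrier
      g q = - 1# * H (suc q) q
      h q = δ * H q q
      -- The new entry l would give two equal columns.
      gl≈0 : g l ≈ 0#
      gl≈0 = trans (*-congˡ (omit-zero _ _ l′ ƛ λ X → alt .vanishing Fin.zero (suc Fin.zero) first ≡.refl)) (zeroʳ _)
      -- All enlarged entries b + k are at most M, so no column of entry M + 1 could have dropped to
      -- M.
      gM≈0 : g (l ℕ.+ (M ∸ l)) ≈ 0#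
      gM≈0 rewrite ℕ.m+[n∸m]≡n l≤M = trans (*-congˡ (omit-zero-coeff (suc j) p λ d b≤l′ →
        transfer-above d (s≤s (ℕ.≤-trans (ℕ.+-monoˡ-≤ k (ℕ.≤-trans b≤l′ l′≤l)) l+k≤M)))) (zeroʳ _)

    -- `U` is the largest entry with which an enlarged column may stay in the current row; `M`
    -- bounds all enlarged entries and is the same for all rows.
    Bounds : ∀ {m} → ℕ → ℕ → ℕ → Vec ℕ m → Set
    Bounds k U M []      = ⊤
    Bounds k U M (l ∷ ƛ) = l ≤ U × U ≤ M × l ℕ.+ k ≤ M

    -- `transfer 0 N` is a Kronecker delta. In this form the enlarged column of the current row
    -- becomes the missing term d = 0 of `omit`.
    ∑-select : ∀ (f : ℕ → Carrier) N p d → p < N → N ≤ p ℕ.+ d →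
      f N ≈ ∑ (λ q → transfer 0 N q * f q) (interval p d)
    ∑-select f N p zero p<N N≤p =
      contradiction (ℕ.≤-trans N≤p (ℕ.≤-reflexive (ℕ.+-identityʳ p))) (ℕ.<⇒≱ p<N)
    ∑-select f N p (suc d) p<N N≤p+d with N ℕ.≟ suc p
    ... | yes ≡.refl rewrite dec-true (N ℕ.≟ N) ≡.refl = sym (trans (+-cong (*-identityˡ _)
      (trans (∑-interval-cong (suc p) d λ v N<v → trans (*-congʳ (transfer-above 0 N<v)) (zeroˡ _))
             (∑-zero (interval (suc p) d)))) (+-identityʳ _))
    ... | no N≢1+p rewrite dec-false (N ℕ.≟ suc p) N≢1+p = trans
      (∑-select f N (suc p) d (ℕ.≤∧≢⇒< p<N (N≢1+p ∘ ≡.sym))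
        (ℕ.≤-trans N≤p+d (ℕ.≤-reflexive (ℕ.+-suc p d))))
      (sym (trans (+-congʳ (zeroˡ _)) (+-identityˡ _)))

    -- By recursion with the bound l, the columns from lower rows that exceed l are pending, and
    -- `transfer-up` lifts them into the current row. With this row's own enlarged column they form
    -- a full `omit` sum for each entry q from l + 1 to M. Those with q ≤ U stay here and expand
    -- into chains; the others remain pending.
    strips-sum : ∀ {m} {F : Vec (Column n) m → Carrier} → Alternating F → ∀ {k} → 1 ≤ k →
      ∀ j U M ƛ → IsPartition ƛ → Bounds k U M ƛ →
      sum (λ b → F (cols j (ƛ [ b ]%= (ℕ._+ k)))) ≈
      ∑ (λ ν → weight k ƛ ν * F (cols j ν)) (strips k U ƛ) + pending F k j U M ƛ
    strips-sum alt 1≤k j U M [] p _ = sym (+-identityʳ 0#)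
    strips-sum {suc m} {F} alt {k} 1≤k j U M (l ∷ ƛ) p (l≤U , U≤M , l+k≤M) = begin
      F (col m j (l ℕ.+ k) ∷ cols (suc j) ƛ) + sum (λ b → F (col m j l ∷ cols (suc j) (ƛ [ b ]%= (ℕ._+ k))))
        ≈⟨ +-cong first-row (strips-sum (alternating-∷ alt (col m j l)) 1≤k (suc j) l M ƛ
             (tail p) (bounds ƛ p)) ⟩
      ∑ top vs + (∑ (λ ν → weight k ƛ ν * F (cols j (l ∷ ν))) (strips k l ƛ) + P ƛ)
        ≈⟨ +-congˡ (+-cong (sym later) (P≈ ƛ p)) ⟩
      ∑ top vs + (∑ w (map (l ∷_) (strips k l ƛ)) + ∑ rest vs)
        ≈⟨ solve 3 (λ a b c → a :+ (b :+ c) := b :+ (a :+ c)) refl _ _ _ ⟩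
      ∑ w (map (l ∷_) (strips k l ƛ)) + (∑ top vs + ∑ rest vs)
        ≈⟨ +-congˡ (∑-+ top rest vs) ⟨
      ∑ w (map (l ∷_) (strips k l ƛ)) + ∑ all vs
        ≈⟨ +-congˡ (trans (reflexive (≡.cong (∑ all) vs≡)) (∑-++ all (interval l (U ∸ l)))) ⟩
      ∑ w (map (l ∷_) (strips k l ƛ)) + (∑ all (interval l (U ∸ l)) + ∑ all (interval U (M ∸ U)))
        ≈⟨ solve 3 (λ a b c → a :+ (b :+ c) := (b :+ a) :+ c) refl _ _ _ ⟩
      (∑ all (interval l (U ∸ l)) + ∑ w (map (l ∷_) (strips k l ƛ))) + ∑ all (interval U (M ∸ U))
        ≈⟨ +-congʳ (+-congʳ now) ⟩
      (∑ w (prepend (interval l (U ∸ l)) heads) + ∑ w (map (l ∷_) (strips k l ƛ))) + ∑ all (interval U (M ∸ U))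
        ≈⟨ +-congʳ (∑-++ w (prepend (interval l (U ∸ l)) heads)) ⟨
      ∑ w (strips k U (l ∷ ƛ)) + ∑ all (interval U (M ∸ U)) ∎
      where
      l≤M = ℕ.≤-trans l≤U U≤M
      vs = interval l (M ∸ l)
      heads : ℕ → List (Vec ℕ m)
      heads v = chains (window? k v) v l ƛ
      w : Vec ℕ (suc m) → Carrier
      w ν = weight k (l ∷ ƛ) ν * F (cols j ν)
      top rest all : ℕ → Carrier
      top q = transfer 0 (l ℕ.+ k) q * F (col m j q ∷ cols (suc j) ƛ)
      rest q = omit⁺ (rowWeight k q) j (λ X → F (col m j q ∷ X)) l ƛ
      all q = omit (rowWeight k q) j (λ X → F (col m j q ∷ X)) l ƛ
      P : Vec ℕ m → Carrier
      P = pending (λ X → F (col m j l ∷ X)) k (suc j) l M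
      tail : ∀ {ƛ} → IsPartition (l ∷ ƛ) → IsPartition {m} ƛ
      tail [-]     = []
      tail (_ ∷ p) = p
      bounds : ∀ ƛ → IsPartition (l ∷ ƛ) → Bounds {m} k l M ƛ
      bounds []       _          = tt
      bounds (l′ ∷ ƛ) (l′≤l ∷ p) = l′≤l , l≤M , ℕ.≤-trans (ℕ.+-monoˡ-≤ k l′≤l) l+k≤M
      first-row : F (col m j (l ℕ.+ k) ∷ cols (suc j) ƛ) ≈ ∑ top vs
      first-row = ∑-select (λ q → F (col m j q ∷ cols (suc j) ƛ)) (l ℕ.+ k) l (M ∸ l)
        (ℕ.m<m+n l 1≤k) (ℕ.≤-trans l+k≤M (ℕ.≤-reflexive (≡.sym (ℕ.m+[n∸m]≡n l≤M))))
      P≈ : ∀ ƛ → IsPartition (l ∷ ƛ) → P ƛ ≈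
        ∑ (λ q → omit⁺ (rowWeight k q) j (λ X → F (col m j q ∷ X)) l ƛ) vs
      P≈ []       _          = sym (∑-zero vs)
      P≈ (l′ ∷ ƛ) (l′≤l ∷ p) = transfer-up alt k j p l′≤l l≤M l+k≤M
      vs≡ : vs ≡ interval l (U ∸ l) ++ interval U (M ∸ U)
      vs≡ = ≡.trans (≡.cong (interval l) M∸l≡) (≡.trans (interval-++ l (U ∸ l) (M ∸ U))
        (≡.cong (λ u → interval l (U ∸ l) ++ interval u (M ∸ U)) (ℕ.m+[n∸m]≡n l≤U)))
        where
        M∸l≡ : M ∸ l ≡ (U ∸ l) ℕ.+ (M ∸ U)
        M∸l≡ = ≡.trans (≡.cong (_∸ l) (≡.sym (ℕ.m+[n∸m]≡n U≤M))) (ℕ.+-∸-comm (M ∸ U) l≤U)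
      later : ∑ w (map (l ∷_) (strips k l ƛ)) ≈ ∑ (λ ν → weight k ƛ ν * F (cols j (l ∷ ν))) (strips k l ƛ)
      later = trans (∑-map w (l ∷_) (strips k l ƛ)) (∑-cong (λ ν → *-congʳ (reflexive (weight-there k l ƛ ν))) (strips k l ƛ))
      now : ∑ all (interval l (U ∸ l)) ≈ ∑ w (prepend (interval l (U ∸ l)) heads)
      now = trans (∑-interval-cong l (U ∸ l) λ v l<v → trans
          (chains-sum alt (window? k v) (rowWeight-outside k v) j p l<v)
          (∑-cong (λ ν → *-congʳ (reflexive (≡.sym (weight-here k ƛ ν l<v)))) (heads v)))
        (sym (∑-prepend w (interval l (U ∸ l)) heads))

    -- The coefficients in closed form

    -- Of the d moves, t lower the entry by one with factor - 1 and the others keep it with factor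
    -- δ; the recurrence is Pascal's rule.
    transfer-binomial : ∀ d {N q} t → q ℕ.+ t ≡ N →
      transfer d N q ≈ (d C t) · ((- 1#) ^ t * δ ^ (d ∸ t))
    transfer-binomial zero {q = q} zero ≡.refl rewrite ℕ.+-identityʳ q | dec-true (q ℕ.≟ q) ≡.refl =
      sym (trans (+-identityʳ _) (*-identityˡ _))
    transfer-binomial zero {q = q} (suc t) ≡.refl
      rewrite dec-false (q ℕ.+ suc t ℕ.≟ q) (ℕ.m+1+n≢m q) | k>n⇒nCk≡0 {0} {suc t} (s≤s z≤n) = refl
    transfer-binomial (suc d) {q = q} zero ≡.refl = begin
      - 1# * transfer d (q ℕ.+ 0) (suc q) + δ * transfer d (q ℕ.+ 0) q
        ≈⟨ +-cong (*-congˡ (transfer-above d (s≤s (ℕ.≤-reflexive (ℕ.+-identityʳ q)))))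
                  (*-congˡ (transfer-binomial d zero ≡.refl)) ⟩
      - 1# * 0# + δ * (1 · (1# * δ ^ d))
        ≈⟨ solve 3 (λ a b c → a :* con 0 :+ b :* (con 1 :* c :+ con 0) :=
                    con 1 :* (b :* c) :+ con 0) refl _ _ _ ⟩
      1 · (1# * δ ^ suc d) ∎
    transfer-binomial (suc d) {q = q} (suc t) ≡.refl = begin
      - 1# * transfer d (q ℕ.+ suc t) (suc q) + δ * transfer d (q ℕ.+ suc t) q
        ≈⟨ +-cong (*-congˡ (transfer-binomial d t (≡.sym (ℕ.+-suc q t))))
                  (*-congˡ (transfer-binomial d (suc t) ≡.refl)) ⟩
      - 1# * ((d C t) · (σ * δ ^ (d ∸ t))) + δ * ((d C suc t) · (- 1# * σ * δ ^ (d ∸ suc t)))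
        ≈⟨ +-cong (trans (×-comm-* (d C t) _ _) (×-congʳ (d C t) (sym (*-assoc _ _ _)))) (absorb (t ℕ.<? d)) ⟩
      (d C t) · (- 1# * σ * δ ^ (d ∸ t)) + (d C suc t) · (- 1# * σ * δ ^ (d ∸ t))
        ≈⟨ ×-homo-+ _ (d C t) (d C suc t) ⟨
      (d C t ℕ.+ d C suc t) · (- 1# * σ * δ ^ (d ∸ t))
        ≈⟨ ×-congˡ (nCk+nC[k+1]≡[n+1]C[k+1] d t) ⟩
      (suc d C suc t) · (- 1# * σ * δ ^ (d ∸ t)) ∎
      where
      σ = (- 1#) ^ t
      absorb : Dec (t < d) → δ * ((d C suc t) · (- 1# * σ * δ ^ (d ∸ suc t))) ≈
        (d C suc t) · (- 1# * σ * δ ^ (d ∸ t))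
      absorb (yes t<d) = trans (×-comm-* (d C suc t) _ _) (×-congʳ (d C suc t) (begin
        δ * (- 1# * σ * δ ^ (d ∸ suc t))   ≈⟨ solve 3 (λ a b c → a :* (b :* c) := b :* (a :* c)) refl _ _ _ ⟩
        - 1# * σ * δ ^ suc (d ∸ suc t)     ≡⟨ ≡.cong (λ e → - 1# * σ * δ ^ e) (ℕ.+-∸-assoc 1 t<d) ⟨
        - 1# * σ * δ ^ (d ∸ t)             ∎))
      -- From t = d on, the truncated exponents `d ∸ t` and `d ∸ suc t` are both 0 and cannot absorb
      -- a factor δ, but the binomial coefficient vanishes.
      absorb (no t≮d) rewrite k>n⇒nCk≡0 {d} {suc t} (s≤s (ℕ.≮⇒≥ t≮d)) = zeroʳ δ

    chainWeight≈ : ∀ {m p q d b e} a {ƛ ν : Vec ℕ m} → Chain p q ƛ ν d b e → IsPartition (p ∷ ƛ) →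
      chainWeight a p ƛ ν ≈ δ ^ e * a d b
    chainWeight≈ a stop pƛ = trans (reflexive (chainWeight-stop a pƛ)) (sym (*-identityˡ _))
    chainWeight≈ {p = p} a (step {v = v} {d} {b} {e} {ƛ} {ν} p<v _ ch) (_ ∷ pƛ) = begin
      chainWeight a p (_ ∷ ƛ) (v ∷ ν)                  ≡⟨ chainWeight-step a ƛ ν p<v ⟩
      δ ^ (v ∸ suc p) * chainWeight (a ∘ suc) _ ƛ ν    ≈⟨ *-congˡ (chainWeight≈ (a ∘ suc) ch pƛ) ⟩
      δ ^ (v ∸ suc p) * (δ ^ e * a (suc d) b)          ≈⟨ *-assoc _ _ _ ⟨
      δ ^ (v ∸ suc p) * δ ^ e * a (suc d) b            ≈⟨ *-congʳ (^-homo-* δ (v ∸ suc p) e) ⟨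
      δ ^ (v ∸ suc p ℕ.+ e) * a (suc d) b              ∎

    weight≈ : ∀ {m U t d b e} k {ƛ ν : Vec ℕ m} → Strip U ƛ ν t d b e → IsPartition ƛ →
      weight k ƛ ν ≈ δ ^ e * rowWeight k t d b
    weight≈ {t = t} k (here {ƛ = ƛ} {ν} l<v _ ch) pƛ =
      trans (reflexive (weight-here k ƛ ν l<v)) (chainWeight≈ (rowWeight k t) ch pƛ)
    weight≈ k (there {l = l} {ƛ = ƛ} {ν} s) pƛ =
      trans (reflexive (weight-there k l ƛ ν)) (weight≈ k s (Linked.tail pƛ))

    -- With c columns, h = k - c of the d = r - 1 moves lowered the entry, which gives the sign and
    -- the binomial coefficient. The other d - h moves and the e adaptations give the power of δ,
    -- and e + d - h is the number of boxes c + e + d minus k. The window makes all these truncated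
    -- subtractions exact.
    strip-coefficient : ∀ {m U t d b e k} {ƛ ν : Vec ℕ m} → Strip U ƛ ν t d b e → Window k t d b →
      IsPartition ƛ → ∀ g → weight k ƛ ν * g ≈
      δ ^ (∣ ν / ƛ ∣ ∸ k) * (- 1#) ^ (k ∸ c[ ν / ƛ ]) * (((r[ ν / ƛ ] ∸ 1) C (k ∸ c[ ν / ƛ ])) · g)
    strip-coefficient {t = t} {d} {b} {e} {k} {ƛ} {ν} s (c≤k , k≤c+d) pƛ g
      = begin
      weight k ƛ ν * g
        ≈⟨ *-congʳ (weight≈ k s pƛ) ⟩
      δ ^ e * transfer d (b ℕ.+ k) t * g
        ≈⟨ *-congʳ (*-congˡ (transfer-binomial d h t+h≡b+k)) ⟩
      δ ^ e * (N · (σ * δ ^ (d ∸ h))) * g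
        ≈⟨ *-congʳ (×-comm-* N _ _) ⟩
      (N · (δ ^ e * (σ * δ ^ (d ∸ h)))) * g
        ≈⟨ ×-assoc-* N _ _ ⟩
      N · (δ ^ e * (σ * δ ^ (d ∸ h)) * g)
        ≈⟨ ×-congʳ N (solve 4 (λ a b c d → a :* (b :* c) :* d := a :* c :* b :* d) refl _ _ _ _) ⟩
      N · (δ ^ e * δ ^ (d ∸ h) * σ * g)
        ≈⟨ ×-comm-* N _ _ ⟨
      δ ^ e * δ ^ (d ∸ h) * σ * (N · g)
        ≈⟨ *-congʳ (*-congʳ (^-homo-* δ e (d ∸ h))) ⟨
      δ ^ (e ℕ.+ (d ∸ h)) * σ * (N · g)
        ≡⟨ ≡.cong (λ x → δ ^ x * σ * (N · g)) exponent ⟩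
      coefficient ((t ∸ b) ℕ.+ (e ℕ.+ d)) (t ∸ b) (suc d)
        ≡⟨ ≡.cong (λ x → coefficient x (t ∸ b) (suc d)) (≡.trans (∣/∣≡size ν ƛ) (strip-size s pƛ)) ⟨
      coefficient ∣ ν / ƛ ∣ (t ∸ b) (suc d)
        ≡⟨ ≡.cong₂ (coefficient ∣ ν / ƛ ∣) (c≡ s pƛ) (r≡ s pƛ) ⟨
      coefficient ∣ ν / ƛ ∣ c[ ν / ƛ ] r[ ν / ƛ ] ∎
      where
      coefficient : ℕ → ℕ → ℕ → Carrier
      coefficient size columns rows =
        δ ^ (size ∸ k) * (- 1#) ^ (k ∸ columns) * (((rows ∸ 1) C (k ∸ columns)) · g)
      h = k ∸ (t ∸ b)
      N = d C h
      σ = (- 1#) ^ h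
      k≡ : k ≡ (t ∸ b) ℕ.+ h
      k≡ = ≡.sym (ℕ.m+[n∸m]≡n c≤k)
      t+h≡b+k : t ℕ.+ h ≡ b ℕ.+ k
      t+h≡b+k = ≡.trans (≡.cong (ℕ._+ h) (≡.sym (ℕ.m+[n∸m]≡n (ℕ.<⇒≤ (strip-<-top s pƛ)))))
        (≡.trans (ℕ.+-assoc b (t ∸ b) h) (≡.cong (b ℕ.+_) (≡.sym k≡)))
      h≤d : h ≤ d
      h≤d = ℕ.m≤n+o⇒m∸n≤o k (t ∸ b) k≤c+d
      exponent : e ℕ.+ (d ∸ h) ≡ (t ∸ b) ℕ.+ (e ℕ.+ d) ∸ k
      exponent = ≡.trans (≡.sym (ℕ.+-∸-assoc e h≤d))
        (≡.trans (≡.sym (ℕ.[m+n]∸[m+o]≡n∸o (t ∸ b) (e ℕ.+ d) h))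
                 (≡.cong ((t ∸ b) ℕ.+ (e ℕ.+ d) ∸_) (≡.sym k≡)))

    lookup-cols : ∀ {m} j (ν : Vec ℕ m) i →
      lookup (cols j ν) i ≡ col (m ∸ suc (toℕ i)) (j ℕ.+ toℕ i) (lookup ν i)
    lookup-cols {suc m} j (v ∷ ν) zero    = ≡.cong (λ j → col m j v) (≡.sym (ℕ.+-identityʳ j))
    lookup-cols {suc m} j (v ∷ ν) (suc i) = ≡.trans (lookup-cols (suc j) ν i)
      (≡.cong (λ j → col (m ∸ suc (toℕ i)) j (lookup ν i)) (≡.sym (ℕ.+-suc j (toℕ i))))

    -- For the first row `U` and `M` are chosen equal, so no column is left that would have to rise
    -- above it.
    pending-empty : ∀ {m} (F : Vec (Column n) m → Carrier) k j U ƛ → pending F k j U U ƛ ≈ 0#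
    pending-empty F k j U []      = refl
    pending-empty {suc m} F k j U (l ∷ ƛ) = reflexive (≡.cong
      (λ d → ∑ (λ q → omit (rowWeight k q) j (λ X → F (col m j q ∷ X)) l ƛ) (interval U d)) (ℕ.n∸n≡0 U))

    bounds : ∀ {m k U} (ƛ : Vec ℕ m) → IsPartition (U ∷ ƛ) → (∀ i → lookup ƛ i ℕ.+ k ≤ U) → Bounds k U U ƛ
    bounds []      _         _ = tt
    bounds (l ∷ ƛ) (l≤U ∷ _) h = l≤U , ℕ.≤-refl , h zero

-- Grothendieck functions and power sums

module PowerSums {c ℓ} (R : CommutativeRing c ℓ) where

  open CommutativeRing R hiding (zero)
  open RingDefs R
  open Determinant R
  open Straightening R
  open Exp semiring hiding (_^_)
  open CommutativeExp commutativeSemiring using (^-distrib-*)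
  open Sum semiring hiding (sum)
  open RingProperties ring using (-‿distribˡ-*; -‿distribʳ-*)
  open Solver commutativeSemiring
  open import Relation.Binary.Reasoning.Setoid setoid

  ^-unit-inverse : ∀ {a} (u : Unit a) m → proj₁ (^-unit u m) ≈ proj₁ u ^ m
  ^-unit-inverse u zero    = refl
  ^-unit-inverse u (suc m) = trans (*-congʳ (^-unit-inverse u m)) (*-comm _ _)

  module Pieri
    {n : ℕ} (α β : Carrier) (x : Vector Carrier n)
    (1-αx-unit : ∀ i → Unit (1# - α * x i))
    (x-x-unit : ∀ i j → i Fin.< j → Unit (x i - x j))
    where

    open Grothendieck α β x 1-αx-unit x-x-unit

    δ : Carrier
    δ = - α - β

    y : Vector Carrier n
    y i = x i * proj₁ (1-αx-unit i)

    col : ℕ → ℕ → ℕ → Vector Carrier n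
    col m j e i = y i ^ e * (x i ^ m * (1# + β * x i) ^ j)

    y[1-αx]≈x : ∀ i → y i * (1# - α * x i) ≈ x i
    y[1-αx]≈x i = trans (*-assoc _ _ _)
      (trans (*-congˡ (proj₁ (proj₂ (1-αx-unit i)))) (*-identityʳ _))

    -- This is x = y (1 - αx) with 1 - αx written as (1 + βx) + δx.
    x≈yu+δyx : ∀ i → x i ≈ y i * (1# + β * x i) + δ * (y i * x i)
    x≈yu+δyx i = sym (begin
      y i * (1# + β * x i) + (- α + - β) * (y i * x i)
        ≈⟨ solve 5 (λ y x b a b′ → y :* (con 1 :+ b :* x) :+ (a :+ b′) :* (y :* x) :=
                    y :* (con 1 :+ a :* x) :+ (b :+ b′) :* (y :* x)) refl (y i) (x i) β (- α) (- β) ⟩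
      y i * (1# + - α * x i) + (β - β) * (y i * x i)
        ≈⟨ +-cong (*-congˡ (+-congˡ (sym (-‿distribˡ-* α (x i))))) (trans (*-congʳ (-‿inverseʳ β)) (zeroˡ _)) ⟩
      y i * (1# - α * x i) + 0#
        ≈⟨ +-identityʳ _ ⟩
      y i * (1# - α * x i)
        ≈⟨ y[1-αx]≈x i ⟩
      x i ∎)

    col-suc : ∀ m j e i → col (suc m) j e i ≈ col m (suc j) (suc e) i + δ * col (suc m) j (suc e) i
    col-suc m j e i = begin
      yᵉ * (x i * xᵐ * uʲ)
        ≈⟨ *-congˡ (*-congʳ (*-congʳ (x≈yu+δyx i))) ⟩
      yᵉ * ((y i * (1# + β * x i) + δ * (y i * x i)) * xᵐ * uʲ)
        ≈⟨ solve 7 (λ Y y w d x X u → Y :* ((y :* w :+ d :* (y :* x)) :* X :* u) :=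
                    y :* Y :* (X :* (w :* u)) :+ d :* (y :* Y :* (x :* X :* u))) refl
             yᵉ (y i) (1# + β * x i) δ (x i) xᵐ uʲ ⟩
      col m (suc j) (suc e) i + δ * col (suc m) j (suc e) i ∎
      where
      yᵉ = y i ^ e
      xᵐ = x i ^ m
      uʲ = (1# + β * x i) ^ j

    open Columns δ col col-suc

    D : Vec (Column n) n → Carrier
    D X = det λ i j → lookup X j i

    Δ⁻¹ : Carrier
    Δ⁻¹ = proj₁ (∏<-unit x-x-unit)

    G≈ : ∀ ν → G ν ≈ D (cols 0 ν) * Δ⁻¹
    G≈ ν = *-congʳ (det-cong λ i j → begin
      x i ^ (lookup ν j ℕ.+ (n ∸ suc (toℕ j))) * (1# + β * x i) ^ toℕ j * proj₁ (^-unit (1-αx-unit i) (lookup ν j))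
        ≈⟨ *-cong (*-congʳ (^-homo-* (x i) (lookup ν j) (n ∸ suc (toℕ j)))) (^-unit-inverse (1-αx-unit i) (lookup ν j)) ⟩
      x i ^ lookup ν j * x i ^ (n ∸ suc (toℕ j)) * (1# + β * x i) ^ toℕ j * proj₁ (1-αx-unit i) ^ lookup ν j
        ≈⟨ solve 4 (λ a b c d → a :* b :* c :* d := a :* d :* (b :* c)) refl _ _ _ _ ⟩
      x i ^ lookup ν j * proj₁ (1-αx-unit i) ^ lookup ν j * (x i ^ (n ∸ suc (toℕ j)) * (1# + β * x i) ^ toℕ j)
        ≈⟨ *-congʳ (^-distrib-* (x i) (proj₁ (1-αx-unit i)) (lookup ν j)) ⟨
      col (n ∸ suc (toℕ j)) (toℕ j) (lookup ν j) i
        ≡⟨ ≡.cong (λ c → c i) (lookup-cols 0 ν j) ⟨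
      lookup (cols 0 ν) j i ∎)

    pᵅ-D : ∀ k ƛ → pᵅ k * D (cols 0 ƛ) ≈ sum λ b → D (cols 0 (ƛ [ b ]%= (ℕ._+ k)))
    pᵅ-D k ƛ = trans (det-scale (λ i → y i ^ k) (λ i j → lookup (cols 0 ƛ) j i))
      (sum-cong-≋ λ b → det-cong λ i j → entry b i j)
      where
      entry : ∀ b i j → (if does (j Fin.≟ b) then y i ^ k else 1#) * lookup (cols 0 ƛ) j i ≈
        lookup (cols 0 (ƛ [ b ]%= (ℕ._+ k))) j i
      entry b i j = begin
        (if does (j Fin.≟ b) then y i ^ k else 1#) * lookup (cols 0 ƛ) j i
          ≡⟨ ≡.cong (λ c → (if does (j Fin.≟ b) then y i ^ k else 1#) * c i) (lookup-cols 0 ƛ j) ⟩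
        (if does (j Fin.≟ b) then y i ^ k else 1#) * col (n ∸ suc (toℕ j)) (toℕ j) (lookup ƛ j) i
          ≈⟨ shift (j Fin.≟ b) ⟩
        col (n ∸ suc (toℕ j)) (toℕ j) (lookup (ƛ [ b ]%= (ℕ._+ k)) j) i
          ≡⟨ ≡.cong (λ c → c i) (lookup-cols 0 (ƛ [ b ]%= (ℕ._+ k)) j) ⟨
        lookup (cols 0 (ƛ [ b ]%= (ℕ._+ k))) j i ∎
        where
        shift : (j≟b : Dec (j ≡ b)) →
          (if does j≟b then y i ^ k else 1#) * col (n ∸ suc (toℕ j)) (toℕ j) (lookup ƛ j) i ≈
          col (n ∸ suc (toℕ j)) (toℕ j) (lookup (ƛ [ b ]%= (ℕ._+ k)) j) i
        shift (yes ≡.refl) = trans (sym (*-assoc _ _ _)) (*-congʳ (trans (*-comm _ _)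
          (trans (sym (^-homo-* (y i) (lookup ƛ j) k))
                 (^-congʳ (y i) (≡.sym (lookup∘updateAt j ƛ))))))
        shift (no j≢b) = trans (*-identityˡ _)
          (*-congʳ (^-congʳ (y i) (≡.sym (lookup∘updateAt′ j b j≢b ƛ))))

    coefficient : ℕ → Vec ℕ n → Vec ℕ n → Carrier → Carrier
    coefficient k ƛ ν g =
      δ ^ (∣ ν / ƛ ∣ ∸ k) * (- 1#) ^ (k ∸ c[ ν / ƛ ]) * (((r[ ν / ƛ ] ∸ 1) C (k ∸ c[ ν / ƛ ])) · g)

    term : ∀ {U k ƛ ν} → IsPartition ƛ →
      ∃[ t ] ∃[ d ] ∃[ b ] ∃[ e ] Strip U ƛ ν t d b e × Window k t d b →
      Δ⁻¹ * (weight k ƛ ν * D (cols 0 ν)) ≈ coefficient k ƛ ν (G ν)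
    term {k = k} {ƛ} {ν} pƛ (_ , _ , _ , _ , s , w) = begin
      Δ⁻¹ * (weight k ƛ ν * D (cols 0 ν))   ≈⟨ solve 3 (λ a b c → a :* (b :* c) := b :* (c :* a)) refl _ _ _ ⟩
      weight k ƛ ν * (D (cols 0 ν) * Δ⁻¹)   ≈⟨ *-congˡ (G≈ ν) ⟨
      weight k ƛ ν * G ν                    ≈⟨ strip-coefficient s w pƛ (G ν) ⟩
      coefficient k ƛ ν (G ν)               ∎

    expansion : ∀ k {U ƛ} → 1 ≤ k → IsPartition ƛ → IsPartition (U ∷ ƛ) → (∀ i → lookup ƛ i ℕ.+ k ≤ U) →
      pᵅ k * G ƛ ≈ ∑ (λ ν → coefficient k ƛ ν (G ν)) (strips k U ƛ)
    expansion k {U} {ƛ} 1≤k pƛ pU bound = begin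
      pᵅ k * G ƛ
        ≈⟨ trans (*-congˡ (G≈ ƛ)) (sym (*-assoc _ _ _)) ⟩
      pᵅ k * D (cols 0 ƛ) * Δ⁻¹
        ≈⟨ *-congʳ (trans (pᵅ-D k ƛ) (strips-sum det-alternating 1≤k 0 U U ƛ pƛ (bounds ƛ pU bound))) ⟩
      (∑ (λ ν → weight k ƛ ν * D (cols 0 ν)) (strips k U ƛ) + pending D k 0 U U ƛ) * Δ⁻¹
        ≈⟨ *-congʳ (trans (+-congˡ (pending-empty D k 0 U ƛ)) (+-identityʳ _)) ⟩
      ∑ (λ ν → weight k ƛ ν * D (cols 0 ν)) (strips k U ƛ) * Δ⁻¹
        ≈⟨ trans (*-comm _ _) (sym (∑-*ˡ Δ⁻¹ (λ ν → weight k ƛ ν * D (cols 0 ν)) (strips k U ƛ))) ⟩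
      ∑ (λ ν → Δ⁻¹ * (weight k ƛ ν * D (cols 0 ν))) (strips k U ƛ)
        ≈⟨ ∑-cong-∈ (strips k U ƛ) (λ ν∈ → term pƛ (∈-strips⁻ k U ν∈)) ⟩
      ∑ (λ ν → coefficient k ƛ ν (G ν)) (strips k U ƛ) ∎

    pieri : ∀ k → 1 ≤ k → ∀ ƛ → IsPartition ƛ →
      pᵅ k * G ƛ ≈∑⟨ Admissible k ƛ ⟩ λ ν → coefficient k ƛ ν (G ν)
    pieri k 1≤k ƛ pƛ =
      strips k U ƛ , strips-unique k U pƛ , (λ ν → mk⇔ to from) , expansion k 1≤k pƛ pU bound
      where
      -- For n ≥ 1, `U` is the first entry of λ plus k. It bounds all enlarged entries, as the
      -- expansion requires, and the first row of every admissible ν, as the enumeration requires.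
      U     = proj₁ (partition-bound k ƛ pƛ)
      pU    = proj₁ (proj₂ (partition-bound k ƛ pƛ))
      bound = proj₂ (proj₂ (partition-bound k ƛ pƛ))
      to : ∀ {ν} → ν ∈ strips k U ƛ → Admissible k ƛ ν
      to ν∈ with _ , _ , _ , _ , s , w ← ∈-strips⁻ k U ν∈ = strip⇒admissible s pU w
      from : ∀ {ν} → Admissible k ƛ ν → ν ∈ strips k U ƛ
      from adm with _ , _ , _ , _ , s , w ← admissible⇒strip 1≤k pƛ bound adm = ∈-strips⁺ s w

theorem2 : ∀ {c ℓ} (R : CommutativeRing c ℓ) →
    let open CommutativeRing R in
    let open RingDefs R in
    (n : ℕ) → 1 ≤ n →
    (α β : Carrier) (x : Vector Carrier n)
    (1-αx-unit : ∀ i → Unit (1# - α * x i))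
    (x-x-unit : ∀ (i j : Fin n) → i Fin.< j → Unit (x i - x j)) →
    let open Grothendieck α β x 1-αx-unit x-x-unit in
    (k : ℕ) → 1 ≤ k →
    (ƛ : Vec ℕ n) → IsPartition ƛ →
    pᵅ k * G ƛ ≈∑⟨ Admissible k ƛ ⟩ λ ν →
    (- α - β) ^ (∣ ν / ƛ ∣ ∸ k)
    * (- 1#) ^ (k ∸ c[ ν / ƛ ])
    * (((r[ ν / ƛ ] ∸ 1) C (k ∸ c[ ν / ƛ ])) · G ν)
theorem2 R n _ α β x 1-αx-unit x-x-unit = PowerSums.Pieri.pieri R α β x 1-αx-unit x-x-unit
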